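{- Let $K_n$ be the complete graph on $n$ vertices, and let $S$, $C$, $\xi$ be the subgraph counting polynomial, the covered components polynomial and the edge elimination polynomial. (i) For all positive integers $a,b,c,\mu\in\mathbb{N}^{+}$, the sequences $n\mapsto S(K_n;a,b,c)$ and $n\mapsto C(K_n;a,b,c)$ are ultimately periodic modulo $\mu$. (ii) Let $a,b,c\in\mathbb{N}^{+}$ and assume that $ab$ divides $c$. Then, for every $\mu\in\mathbb{N}^{+}$, the sequence $n\mapsto \xi(K_n;a,b,c)$ is ultimately periodic modulo $\mu$.
   Context: Let $G=(V,E)$ be a finite simple graph. For a graph $H$, $\kappa(H)$ denotes the number of connected components of $H$ and $c(H)$ the number of connected components of $H$ that have at least one edge; for $A\subseteq E$ write $\kappa(A)=\kappa((V,A))$ and $c(A)=c((V,A))$. Subgraph counting polynomial: $S(G;X,Y,Z)=\sum_{H=(W,F)\subseteq G}X^{|W|}Y^{\kappa(H)}Z^{|F|}$, where $H$ ranges over all (not necessarily induced) subgraphs of $G$, i.e. $W\subseteq V$ and $F\subseteq E$ with all endpoints of edges in $F$ lying in $W$. Covered components polynomial: $C(G;X,Y,Z)=\sum_{A\subseteq E}X^{\kappa(A)}Y^{|A|}Z^{c(A)}$. Edge elimination polynomial: $\xi(G;X,Y,Z)=\sum_{(A\sqcup B)\subseteq E}X^{\kappa(A\sqcup B)-c(B)}\,Y^{|A|+|B|-c(B)}\,Z^{c(B)}$, where the sum is over all ordered pairs $(A,B)$ of subsets of $E$ such that the set of vertices covered by edges of $A$ and the set of vertices covered by edges of $B$ are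 disjoint, and $A\sqcup B$ denotes their union. An integer sequence $(s_n)_{n\ge 1}$ is ultimately periodic modulo $\mu$ if there exist $N\ge 1$ and $p\ge 1$ such that $s_{n+p}\equiv s_n \pmod{\mu}$ for all $n\ge N$. -}

module Defs where

open import Data.Nat.Base using (ℕ; _+_; _*_; _∸_; _^_; _≤_)
open import Data.Nat.ListAction using (sum)
open import Data.Fin.Base using (Fin) renaming (_<_ to _<ᶠ_)
open import Data.Fin.Properties using (_≟_; all?) renaming (_<?_ to _<ᶠ?_)
open import Data.Integer.Base as ℤ using (ℤ; +_)
import Data.Integer.Divisibility as ℤ
open import Data.List.Base
  using (List; []; _∷_; _++_; map; filter; length; allFin; cartesianProduct; deduplicate)
open import Data.List.Relation.Unary.All as All using (All)
open import Data.List.Relation.Unary.Any as Any using (Any; here; there)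
open import Data.List.Membership.Propositional using (_∈_)
open import Data.Product.Base using (_×_; _,_; proj₁; proj₂; ∃-syntax)
open import Data.Sum.Base using (_⊎_; inj₁; inj₂)
open import Function.Base using (_∘_)
open import Level using (0ℓ)
open import Relation.Binary.Core using (Rel)
open import Relation.Binary.Definitions using (Decidable; Symmetric; Irreflexive)
open import Relation.Binary.Construct.Closure.Equivalence as Eq using (EqClosure)
open import Relation.Binary.Construct.Closure.ReflexiveTransitive using (ε; _◅_; _◅◅_)
open import Relation.Binary.Construct.Closure.Symmetric using (fwd; bwd)
open import Relation.Binary.PropositionalEquality using (_≡_; _≢_; refl; sym)
open import Relation.Nullary.Decidable using (Dec; ¬?; map′; _×-dec_; _⊎-dec_)
open import Relation.Nullary.Negation using (¬_)
open import Relation.Unary as U using ()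

import Data.List.Membership.DecPropositional as DecMembership

record Graph (n : ℕ) : Set₁ where
  field
    Adj    : Rel (Fin n) 0ℓ
    adj?   : Decidable Adj
    symm   : Symmetric Adj
    irrefl : Irreflexive _≡_ Adj

K : (n : ℕ) → Graph n
K n = record
  { Adj    = _≢_
  ; adj?   = λ u v → ¬? (u ≟ v)
  ; symm   = λ u≢v v≡u → u≢v (sym v≡u)
  ; irrefl = λ u≡v u≢v → u≢v u≡v
  }

-- The edge {u , v} is stored once, as the pair (u , v) with u < v.
Edge : ℕ → Set
Edge n = Fin n × Fin n

edges : ∀ {n} → Graph n → List (Edge n)
edges {n} G =
  filter (λ e → (proj₁ e <ᶠ? proj₂ e) ×-dec Graph.adj? G (proj₁ e) (proj₂ e))
         (cartesianProduct (allFin n) (allFin n))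

-- For a list without repetitions, every subset of its elements is listed
-- exactly once (itself as a list without repetitions).
subsets : ∀ {A : Set} → List A → List (List A)
subsets []       = [] ∷ []
subsets (x ∷ xs) = map (x ∷_) (subsets xs) ++ subsets xs

Connected : ∀ {n} → List (Edge n) → Rel (Fin n) 0ℓ
Connected F = EqClosure (λ u v → (u , v) ∈ F)

-- Two vertices are connected in F ∪ {ij} iff they are connected in F, or
-- joined by a walk that uses the edge ij once.
private
  module _ {n} (i j : Fin n) (F : List (Edge n)) where

    Via : Rel (Fin n) 0ℓ
    Via u v = Connected F u v
            ⊎ (Connected F u i × Connected F j v)
            ⊎ (Connected F u j × Connected F i v)

    fromVia : ∀ {u v} → Via u v → Connected ((i , j) ∷ F) u v
    fromVia (inj₁ p)              = Eq.map there p
    fromVia (inj₂ (inj₁ (p , q))) = Eq.map there p ◅◅ fwd (here refl) ◅ Eq.map there q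
    fromVia (inj₂ (inj₂ (p , q))) = Eq.map there p ◅◅ bwd (here refl) ◅ Eq.map there q

    toVia : ∀ {u v} → Connected ((i , j) ∷ F) u v → Via u v
    toVia ε = inj₁ ε
    toVia (fwd (there e) ◅ p) with toVia p
    ... | inj₁ q              = inj₁ (fwd e ◅ q)
    ... | inj₂ (inj₁ (q , r)) = inj₂ (inj₁ (fwd e ◅ q , r))
    ... | inj₂ (inj₂ (q , r)) = inj₂ (inj₂ (fwd e ◅ q , r))
    toVia (bwd (there e) ◅ p) with toVia p
    ... | inj₁ q              = inj₁ (bwd e ◅ q)
    ... | inj₂ (inj₁ (q , r)) = inj₂ (inj₁ (bwd e ◅ q , r))
    ... | inj₂ (inj₂ (q , r)) = inj₂ (inj₂ (bwd e ◅ q , r))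
    toVia (fwd (here refl) ◅ p) with toVia p
    ... | inj₁ q              = inj₂ (inj₁ (ε , q))
    ... | inj₂ (inj₁ (_ , r)) = inj₂ (inj₁ (ε , r))
    ... | inj₂ (inj₂ (_ , r)) = inj₁ r
    toVia (bwd (here refl) ◅ p) with toVia p
    ... | inj₁ q              = inj₂ (inj₂ (ε , q))
    ... | inj₂ (inj₁ (_ , r)) = inj₁ r
    ... | inj₂ (inj₂ (_ , r)) = inj₂ (inj₂ (ε , r))

connected? : ∀ {n} (F : List (Edge n)) → Decidable (Connected F)
connected? [] u v = map′ (λ { refl → ε }) fromε (u ≟ v)
  where
  fromε : ∀ {u v} → Connected [] u v → u ≡ v
  fromε ε            = refl
  fromε (fwd () ◅ _)
  fromε (bwd () ◅ _)
connected? ((i , j) ∷ F) u v =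
  map′ (fromVia i j F) (toVia i j F)
    (connected? F u v
      ⊎-dec (connected? F u i ×-dec connected? F j v)
      ⊎-dec (connected? F u j ×-dec connected? F i v))

-- One representative vertex for each connected component of (W , F).
components : ∀ {n} → List (Fin n) → List (Edge n) → List (Fin n)
components W F = deduplicate (connected? F) W

HasEdge : ∀ {n} → List (Edge n) → U.Pred (Fin n) 0ℓ
HasEdge F v = Any (λ e → Connected F v (proj₁ e)) F

hasEdge? : ∀ {n} (F : List (Edge n)) → U.Decidable (HasEdge F)
hasEdge? F v = Any.any? (λ e → connected? F v (proj₁ e)) F

κ′ : ∀ {n} → List (Fin n) → List (Edge n) → ℕ
κ′ W F = length (components W F)

c′ : ∀ {n} → List (Fin n) → List (Edge n) → ℕ
c′ W F = length (filter (hasEdge? F) (components W F))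

κ : ∀ {n} → List (Edge n) → ℕ
κ {n} A = κ′ (allFin n) A

c : ∀ {n} → List (Edge n) → ℕ
c {n} A = c′ (allFin n) A

EndpointsIn : ∀ {n} → List (Fin n) → List (Edge n) → Set
EndpointsIn W = All (λ e → proj₁ e ∈ W × proj₂ e ∈ W)

endpointsIn? : ∀ {n} (W : List (Fin n)) → U.Decidable (EndpointsIn W)
endpointsIn? W = All.all? (λ e → (proj₁ e ∈? W) ×-dec (proj₂ e ∈? W))
  where open DecMembership _≟_ using (_∈?_)

subgraphs : ∀ {n} → Graph n → List (List (Fin n) × List (Edge n))
subgraphs {n} G =
  filter (λ H → endpointsIn? (proj₁ H) (proj₂ H))
         (cartesianProduct (subsets (allFin n)) (subsets (edges G)))

Covered : ∀ {n} → List (Edge n) → U.Pred (Fin n) 0ℓ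
Covered A v = Any (λ e → proj₁ e ≡ v ⊎ proj₂ e ≡ v) A

covered? : ∀ {n} (A : List (Edge n)) → U.Decidable (Covered A)
covered? A v = Any.any? (λ e → (proj₁ e ≟ v) ⊎-dec (proj₂ e ≟ v)) A

VertexDisjoint : ∀ {n} → Rel (List (Edge n)) 0ℓ
VertexDisjoint A B = ∀ v → ¬ (Covered A v × Covered B v)

vertexDisjoint? : ∀ {n} → Decidable (VertexDisjoint {n})
vertexDisjoint? A B = all? (λ v → ¬? (covered? A v ×-dec covered? B v))

disjointPairs : ∀ {n} → Graph n → List (List (Edge n) × List (Edge n))
disjointPairs G =
  filter (λ P → vertexDisjoint? (proj₁ P) (proj₂ P))
         (cartesianProduct (subsets (edges G)) (subsets (edges G)))

S : ∀ {n} → Graph n → (X Y Z : ℕ) → ℕ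
S G X Y Z =
  sum (map (λ (W , F) → X ^ length W * Y ^ κ′ W F * Z ^ length F) (subgraphs G))

C : ∀ {n} → Graph n → (X Y Z : ℕ) → ℕ
C G X Y Z =
  sum (map (λ A → X ^ κ A * Y ^ length A * Z ^ c A) (subsets (edges G)))

-- Truncated subtraction is exact here.  The components of (V , B) that have an
-- edge are also components of (V , A ⊔ B), so c B ≤ κ (A ⊔ B); and choosing an
-- edge in each of them gives c B ≤ |B|.
ξ : ∀ {n} → Graph n → (X Y Z : ℕ) → ℕ
ξ G X Y Z =
  sum (map (λ (A , B) → X ^ (κ (A ++ B) ∸ c B)
                      * Y ^ (length A + length B ∸ c B)
                      * Z ^ c B)
           (disjointPairs G))

UltimatelyPeriodicMod : ℕ → (ℕ → ℤ) → Set
UltimatelyPeriodicMod μ s =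
  ∃[ N ] ∃[ p ] 1 ≤ N × 1 ≤ p × (∀ n → N ≤ n → + μ ℤ.∣ s (n + p) ℤ.- s n)

{-# OPTIONS --safe #-}
-- All three values are, modulo μ, partition functions
--   Z n α = Σ over f : Fin n → Fin k of ∏ᵥ α (f v) * ∏_{u < v} β (f u) (f v)
-- of the complete graph with k colours.  Removing one vertex gives
--   Z (1 + n) α = Σ_c α c * Z n (α · β c),
-- so the map α ↦ Z n α mod μ determines the map for 1 + n.  It is one of the
-- finitely many maps (ℤ/μ)ᵏ → ℤ/μ, hence Z is ultimately periodic modulo μ.
--
-- To obtain the partition functions, expand the product of the edge factors
-- 1 + y [f u = f v] over subsets A of the edges: the colourings that are
-- constant on every edge of A contribute a product over the components of
-- (V , A).  An extra dead colour, forbidden at the ends of edges, marks the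
-- vertices outside W in S.  In C and ξ its weight corrects the contribution of
-- isolated vertices; the correction is negative, which is why this works only
-- modulo μ.  In ξ with Z = X Y t, the powers of X and Y absorb the exponent
-- - c(B), leaving X^κ(A ⊔ B) Y^(|A| + |B|) t^c(B): there are X colours for the
-- components of A and X t for those of B.
module Submission where

open import Defs
import Algebra.Properties.CommutativeSemigroup as CommutativeSemigroupProperties
open import Data.Bool.Base using (true; false; not; if_then_else_)
open import Data.Fin.Base using (Fin; zero; suc; toℕ; funToFin; finToFun; _↑ˡ_; _↑ʳ_)
import Data.Fin.Properties as Fin
import Data.Integer.Base as ℤ
import Data.Integer.Divisibility as ℤ
import Data.Integer.Properties as ℤ
open import Data.List.Base
  using (List; []; _∷_; _++_; map; filter; length; allFin; tabulate; cartesianProduct;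
         cartesianProductWith; deduplicate)
import Data.List.Membership.DecPropositional as DecMembership
open import Data.List.Membership.Propositional using (_∈_; _∉_; find; lose)
open import Data.List.Membership.Propositional.Properties
  using (∈-allFin; ∈-map⁺; ∈-map⁻; ∈-++⁻; ∈-++⁺ˡ; ∈-++⁺ʳ; ∈-filter⁺)
open import Data.List.Properties
  using (map-∘; map-tabulate; length-tabulate; length-filter;
         filter-all; filter-accept; filter-reject; filter-≐; filter-notAll)
open import Data.List.Relation.Unary.All as All using (All; []; _∷_)
import Data.List.Relation.Unary.All.Properties as Allₚ
open import Data.List.Relation.Unary.AllPairs as AllPairs using (AllPairs; []; _∷_)
import Data.List.Relation.Unary.AllPairs.Properties as AllPairsₚ
open import Data.List.Relation.Unary.Any as Any using (Any; here; there)
import Data.List.Relation.Unary.Any.Properties as Anyₚ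
open import Data.List.Relation.Unary.Unique.Propositional using (Unique)
open import Data.List.Relation.Unary.Unique.Propositional.Properties using (allFin⁺)
open import Data.Nat.Base
  using (ℕ; zero; suc; _+_; _*_; _^_; _∸_; _≤_; _<_; z≤n; s≤s; z<s; ∣_-_∣; NonZero)
open import Data.Nat.Divisibility using (_∣_; divides)
open import Data.Nat.DivMod
  using (_%_; _/_; _mod_; m%n<n; m≡m%n+[m/n]*n; m%n%n≡m%n; [m+kn]%n≡m%n;
         %-distribˡ-+; %-distribˡ-*)
open import Data.Nat.ListAction using (sum; product)
open import Data.Nat.Properties
open import Data.Nat.Tactic.RingSolver using (solve-∀)
open import Data.Product.Base using (_×_; _,_; proj₁; proj₂; ∃)
open import Data.Sum.Base using (_⊎_; inj₁; inj₂; [_,_]′)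
open import Data.Vec.Functional using () renaming (_∷_ to _∷ᶠ_)
open import Function.Base using (_∘_; id; const; _on_)
open import Function.Bundles using (mk⇔)
open import Level using (0ℓ)
open import Relation.Binary.Bundles using (Setoid)
import Relation.Binary.Construct.Closure.Equivalence as Eq
open import Relation.Binary.Construct.Closure.ReflexiveTransitive using (ε; _◅_)
open import Relation.Binary.Construct.Closure.Symmetric using (fwd; bwd)
import Relation.Binary.Construct.On as On
open import Relation.Binary.Core using (Rel)
open import Relation.Binary.Definitions using (Decidable)
open import Relation.Binary.PropositionalEquality
import Relation.Binary.Reasoning.Setoid as SetoidReasoning
open import Relation.Binary.Structures using (IsEquivalence)
open import Relation.Nullary.Decidable
  using (Dec; yes; no; does; ¬?; _×-dec_; _→-dec_; dec-true; dec-false; does-⇔)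
open import Relation.Nullary.Negation using (¬_; contradiction)
open import Relation.Unary as U using (Pred)

private
  module +-Properties = CommutativeSemigroupProperties +-commutativeSemigroup
  module *-Properties = CommutativeSemigroupProperties *-commutativeSemigroup

  variable
    A B D : Set
    P Q : Set

-- Finite sums and products over lists.

∑ ∏ : List A → (A → ℕ) → ℕ
∑ xs f = sum (map f xs)
∏ xs f = product (map f xs)

syntax ∑ xs (λ x → e) = ∑[ x ← xs ] e
syntax ∏ xs (λ x → e) = ∏[ x ← xs ] e
infix 5 ∑ ∏

module _ {f g : A → ℕ} where

  ∑-cong-∈ : ∀ xs → (∀ {x} → x ∈ xs → f x ≡ g x) → ∑ xs f ≡ ∑ xs g
  ∑-cong-∈ []       eq = refl
  ∑-cong-∈ (x ∷ xs) eq = cong₂ _+_ (eq (here refl)) (∑-cong-∈ xs (eq ∘ there))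

  ∏-cong-∈ : ∀ xs → (∀ {x} → x ∈ xs → f x ≡ g x) → ∏ xs f ≡ ∏ xs g
  ∏-cong-∈ []       eq = refl
  ∏-cong-∈ (x ∷ xs) eq = cong₂ _*_ (eq (here refl)) (∏-cong-∈ xs (eq ∘ there))

  ∑-cong : ∀ xs → (∀ x → f x ≡ g x) → ∑ xs f ≡ ∑ xs g
  ∑-cong xs eq = ∑-cong-∈ xs (λ {x} _ → eq x)

  ∏-cong : ∀ xs → (∀ x → f x ≡ g x) → ∏ xs f ≡ ∏ xs g
  ∏-cong xs eq = ∏-cong-∈ xs (λ {x} _ → eq x)

∑-++ : ∀ (f : A → ℕ) xs ys → ∑ (xs ++ ys) f ≡ ∑ xs f + ∑ ys f
∑-++ f []       ys = refl
∑-++ f (x ∷ xs) ys = trans (cong (f x +_) (∑-++ f xs ys)) (sym (+-assoc (f x) _ _))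

∏-++ : ∀ (f : A → ℕ) xs ys → ∏ (xs ++ ys) f ≡ ∏ xs f * ∏ ys f
∏-++ f []       ys = sym (+-identityʳ _)
∏-++ f (x ∷ xs) ys = trans (cong (f x *_) (∏-++ f xs ys)) (sym (*-assoc (f x) _ _))

∑-map : ∀ (g : A → B) (f : B → ℕ) xs → ∑ (map g xs) f ≡ ∑ xs (f ∘ g)
∑-map g f xs = cong sum (sym (map-∘ xs))

∏-map : ∀ (g : A → B) (f : B → ℕ) xs → ∏ (map g xs) f ≡ ∏ xs (f ∘ g)
∏-map g f xs = cong product (sym (map-∘ xs))

∑-+ : ∀ (f g : A → ℕ) xs → ∑[ x ← xs ] (f x + g x) ≡ ∑ xs f + ∑ xs g
∑-+ f g []       = refl
∑-+ f g (x ∷ xs) = trans (cong (f x + g x +_) (∑-+ f g xs)) (+-Properties.interchange (f x) (g x) _ _)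

∏-* : ∀ (f g : A → ℕ) xs → ∏[ x ← xs ] (f x * g x) ≡ ∏ xs f * ∏ xs g
∏-* f g []       = refl
∏-* f g (x ∷ xs) = trans (cong (f x * g x *_) (∏-* f g xs)) (*-Properties.interchange (f x) (g x) _ _)

∑-*ˡ : ∀ a (f : A → ℕ) xs → ∑[ x ← xs ] (a * f x) ≡ a * ∑ xs f
∑-*ˡ a f []       = sym (*-zeroʳ a)
∑-*ˡ a f (x ∷ xs) = trans (cong (a * f x +_) (∑-*ˡ a f xs)) (sym (*-distribˡ-+ a (f x) _))

∑-*ʳ : ∀ (f : A → ℕ) a xs → ∑[ x ← xs ] (f x * a) ≡ ∑ xs f * a
∑-*ʳ f a xs = trans (∑-cong xs (λ x → *-comm (f x) a)) (trans (∑-*ˡ a f xs) (*-comm a _))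

∑-0 : ∀ (xs : List A) → ∑[ _ ← xs ] 0 ≡ 0
∑-0 []       = refl
∑-0 (x ∷ xs) = ∑-0 xs

∏-1 : ∀ (xs : List A) → ∏[ _ ← xs ] 1 ≡ 1
∏-1 []       = refl
∏-1 (x ∷ xs) = trans (+-identityʳ _) (∏-1 xs)

∏-const : ∀ a (xs : List A) → ∏[ _ ← xs ] a ≡ a ^ length xs
∏-const a []       = refl
∏-const a (x ∷ xs) = cong (a *_) (∏-const a xs)

∑-swap : ∀ (f : A → B → ℕ) xs ys →
         ∑[ x ← xs ] ∑[ y ← ys ] f x y ≡ ∑[ y ← ys ] ∑[ x ← xs ] f x y
∑-swap f []       ys = sym (∑-0 ys)
∑-swap f (x ∷ xs) ys =
  trans (cong (∑ ys (f x) +_) (∑-swap f xs ys)) (sym (∑-+ (f x) _ ys))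

∑-cartesianProductWith : ∀ (_⊗_ : A → B → D) (f : D → ℕ) xs ys →
  ∑ (cartesianProductWith _⊗_ xs ys) f ≡ ∑[ x ← xs ] ∑[ y ← ys ] f (x ⊗ y)
∑-cartesianProductWith _⊗_ f []       ys = refl
∑-cartesianProductWith _⊗_ f (x ∷ xs) ys =
  trans (∑-++ f (map (x ⊗_) ys) _)
        (cong₂ _+_ (∑-map (x ⊗_) f ys) (∑-cartesianProductWith _⊗_ f xs ys))

∏-cartesianProductWith : ∀ (_⊗_ : A → B → D) (f : D → ℕ) xs ys →
  ∏ (cartesianProductWith _⊗_ xs ys) f ≡ ∏[ x ← xs ] ∏[ y ← ys ] f (x ⊗ y)
∏-cartesianProductWith _⊗_ f []       ys = refl
∏-cartesianProductWith _⊗_ f (x ∷ xs) ys =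
  trans (∏-++ f (map (x ⊗_) ys) _)
        (cong₂ _*_ (∏-map (x ⊗_) f ys) (∏-cartesianProductWith _⊗_ f xs ys))

allFin-suc : ∀ n → allFin (suc n) ≡ zero ∷ map suc (allFin n)
allFin-suc n = cong (zero ∷_) (sym (map-tabulate id suc))

∑-allFin-suc : ∀ n (f : Fin (suc n) → ℕ) →
               ∑ (allFin (suc n)) f ≡ f zero + ∑ (allFin n) (f ∘ suc)
∑-allFin-suc n f =
  trans (cong (λ xs → ∑ xs f) (allFin-suc n)) (cong (f zero +_) (∑-map suc f (allFin n)))

∏-allFin-suc : ∀ n (f : Fin (suc n) → ℕ) →
               ∏ (allFin (suc n)) f ≡ f zero * ∏ (allFin n) (f ∘ suc)
∏-allFin-suc n f =
  trans (cong (λ xs → ∏ xs f) (allFin-suc n)) (cong (f zero *_) (∏-map suc f (allFin n)))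

-- Expanding the product means choosing, for each `x`, either the 1 or `f x`; the places where `f x`
-- is chosen form the subset `ys`.
∑-subsets : ∀ (f : A → ℕ) xs → ∑[ ys ← subsets xs ] ∏ ys f ≡ ∏[ x ← xs ] (1 + f x)
∑-subsets f []       = refl
∑-subsets f (x ∷ xs) = begin
  ∑[ ys ← map (x ∷_) (subsets xs) ++ subsets xs ] ∏ ys f
    ≡⟨ ∑-++ (λ ys → ∏ ys f) (map (x ∷_) (subsets xs)) _ ⟩
  (∑[ ys ← map (x ∷_) (subsets xs) ] ∏ ys f) + s
    ≡⟨ cong (_+ s) (trans (∑-map (x ∷_) _ (subsets xs)) (∑-*ˡ (f x) _ (subsets xs))) ⟩
  f x * s + s
    ≡⟨ +-comm (f x * s) s ⟩
  (1 + f x) * s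
    ≡⟨ cong ((1 + f x) *_) (∑-subsets f xs) ⟩
  (1 + f x) * (∏[ y ← xs ] (1 + f y)) ∎
  where
  open ≡-Reasoning
  s : ℕ
  s = ∑[ ys ← subsets xs ] ∏ ys f

-- Indicators of decidable propositions.

𝟙 : Dec P → ℕ
𝟙 p? = if does p? then 1 else 0

𝟙-yes : (p? : Dec P) → P → 𝟙 p? ≡ 1
𝟙-yes p? p = cong (if_then 1 else 0) (dec-true p? p)

𝟙-no : (p? : Dec P) → ¬ P → 𝟙 p? ≡ 0
𝟙-no p? ¬p = cong (if_then 1 else 0) (dec-false p? ¬p)

𝟙-⇔ : (p? : Dec P) (q? : Dec Q) → (P → Q) → (Q → P) → 𝟙 p? ≡ 𝟙 q?
𝟙-⇔ (yes p) q? to from = sym (𝟙-yes q? (to p))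
𝟙-⇔ (no ¬p) q? to from = sym (𝟙-no q? (¬p ∘ from))

𝟙-× : (p? : Dec P) (q? : Dec Q) → 𝟙 (p? ×-dec q?) ≡ 𝟙 p? * 𝟙 q?
𝟙-× (yes _) (yes _) = refl
𝟙-× (yes _) (no _)  = refl
𝟙-× (no _)  _       = refl

𝟙-*-cong : (p? : Dec P) {a b : ℕ} → (P → a ≡ b) → 𝟙 p? * a ≡ 𝟙 p? * b
𝟙-*-cong (yes p) eq = cong (1 *_) (eq p)
𝟙-*-cong (no _)  eq = refl

module _ {P : Pred A 0ℓ} (P? : U.Decidable P) where

  ∏-𝟙 : ∀ xs → ∏[ x ← xs ] 𝟙 (P? x) ≡ 𝟙 (All.all? P? xs)
  ∏-𝟙 []       = refl
  ∏-𝟙 (x ∷ xs) = begin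
    𝟙 (P? x) * (∏[ y ← xs ] 𝟙 (P? y)) ≡⟨ cong (𝟙 (P? x) *_) (∏-𝟙 xs) ⟩
    𝟙 (P? x) * 𝟙 (All.all? P? xs)     ≡⟨ 𝟙-× (P? x) (All.all? P? xs) ⟨
    𝟙 (P? x ×-dec All.all? P? xs)
      ≡⟨ 𝟙-⇔ (P? x ×-dec All.all? P? xs) (All.all? P? (x ∷ xs))
             (λ (p , ps) → p ∷ ps) (λ { (p ∷ ps) → p , ps }) ⟩
    𝟙 (All.all? P? (x ∷ xs))          ∎
    where open ≡-Reasoning

  ∑-filter : ∀ (f : A → ℕ) xs → ∑ (filter P? xs) f ≡ ∑[ x ← xs ] (𝟙 (P? x) * f x)
  ∑-filter f []       = refl
  ∑-filter f (x ∷ xs) with does (P? x)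
  ... | true  = cong₂ _+_ (sym (+-identityʳ (f x))) (∑-filter f xs)
  ... | false = ∑-filter f xs

  ∏-filter : ∀ (f : A → ℕ) xs →
             ∏ (filter P? xs) f ≡ ∏[ x ← xs ] (if does (P? x) then f x else 1)
  ∏-filter f []       = refl
  ∏-filter f (x ∷ xs) with does (P? x)
  ... | true  = cong (f x *_) (∏-filter f xs)
  ... | false = trans (∏-filter f xs) (sym (+-identityʳ _))

-- Representatives of equivalence classes

filter-cong : ∀ {P Q : Pred A 0ℓ} (P? : U.Decidable P) (Q? : U.Decidable Q) xs →
  (∀ {x} → x ∈ xs → does (P? x) ≡ does (Q? x)) → filter P? xs ≡ filter Q? xs
filter-cong P? Q? []       eq = refl
filter-cong P? Q? (x ∷ xs) eq
  with ih ← filter-cong P? Q? xs (eq ∘ there) | does (P? x) | does (Q? x) | eq (here refl)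
... | true  | .true  | refl = cong (x ∷_) ih
... | false | .false | refl = ih

filter-map : ∀ {P : Pred B 0ℓ} (P? : U.Decidable P) (g : A → B) xs →
             filter P? (map g xs) ≡ map g (filter (P? ∘ g) xs)
filter-map P? g []       = refl
filter-map P? g (x ∷ xs) with ih ← filter-map P? g xs | does (P? (g x))
... | true  = cong (g x ∷_) ih
... | false = ih

filter-comm : ∀ {P Q : Pred A 0ℓ} (P? : U.Decidable P) (Q? : U.Decidable Q) xs →
              filter P? (filter Q? xs) ≡ filter Q? (filter P? xs)
filter-comm P? Q? []       = refl
filter-comm P? Q? (x ∷ xs)
  with ih ← filter-comm P? Q? xs | does (P? x) in p | does (Q? x) in q
... | true  | true  rewrite p | q = cong (x ∷_) ih
... | true  | false rewrite q     = ih
... | false | true  rewrite p     = ih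
... | false | false               = ih

filter-absorb : ∀ {P Q : Pred A 0ℓ} (P? : U.Decidable P) (Q? : U.Decidable Q) →
                (∀ {x} → P x → Q x) → ∀ xs → filter P? (filter Q? xs) ≡ filter P? xs
filter-absorb P? Q? P⇒Q xs = trans (filter-comm P? Q? xs) (filter-all Q? (All.map P⇒Q (Allₚ.all-filter P? xs)))

deduplicate-map : ∀ {R : Rel B 0ℓ} (R? : Decidable R) (g : A → B) xs →
  deduplicate R? (map g xs) ≡ map g (deduplicate (λ x y → R? (g x) (g y)) xs)
deduplicate-map R? g []       = refl
deduplicate-map R? g (x ∷ xs) = cong (g x ∷_)
  (trans (cong (filter (¬? ∘ R? (g x))) (deduplicate-map R? g xs))
         (filter-map (¬? ∘ R? (g x)) g (deduplicate (λ x y → R? (g x) (g y)) xs)))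

deduplicate-cong : ∀ {R S : Rel A 0ℓ} (R? : Decidable R) (S? : Decidable S) xs →
  (∀ {x y} → x ∈ xs → y ∈ xs → does (R? x y) ≡ does (S? x y)) →
  deduplicate R? xs ≡ deduplicate S? xs
deduplicate-cong R? S? []       eq = refl
deduplicate-cong R? S? (x ∷ xs) eq = cong (x ∷_)
  (trans (cong (filter (¬? ∘ R? x)) (deduplicate-cong R? S? xs (λ p q → eq (there p) (there q))))
         (filter-cong (¬? ∘ R? x) (¬? ∘ S? x) _
           (λ p → cong not (eq (here refl) (there (Anyₚ.deduplicate⁻ S? p))))))

-- A head `x` outside `P` makes `deduplicate` drop only later elements related to `x`, and by
-- `closed` these lie outside `P` too.
filter-deduplicate : ∀ {R : Rel A 0ℓ} (R? : Decidable R) {P : Pred A 0ℓ} (P? : U.Decidable P) →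
  (∀ {x y} → R x y → P y → P x) → ∀ xs →
  filter P? (deduplicate R? xs) ≡ deduplicate R? (filter P? xs)
filter-deduplicate R? P? closed []       = refl
filter-deduplicate R? {P} P? closed (x ∷ xs) with ih ← filter-deduplicate R? P? closed xs | P? x
... | yes p = cong (x ∷_)
  (trans (filter-comm P? (¬? ∘ R? x) (deduplicate R? xs)) (cong (filter (¬? ∘ R? x)) ih))
... | no ¬p =
  trans (filter-absorb P? (¬? ∘ R? x) (λ q r → ¬p (closed r q)) (deduplicate R? xs)) ih

module _ {R : Rel A 0ℓ} (R? : Decidable R) (≈ : IsEquivalence R) where
  private module ≈ = IsEquivalence ≈

  -- Exactly one representative of `xs` lies in the class of `x`. It need not be `x` itself, but `M`
  -- takes the same value on it.
  ∏-remove-class : ∀ (M : A → ℕ) → (∀ {x y} → R x y → M x ≡ M y) → ∀ {x} xs → Any (R x) xs →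
    M x * ∏ (filter (¬? ∘ R? x) (deduplicate R? xs)) M ≡ ∏ (deduplicate R? xs) M
  ∏-remove-class M M-resp {x} (y ∷ ys) x∼ with R? x y
  ... | yes r = cong₂ _*_ (M-resp r) (cong (λ zs → ∏ zs M)
    (trans (filter-absorb (¬? ∘ R? x) (¬? ∘ R? y) x⇒y ds)
           (filter-≐ (¬? ∘ R? x) (¬? ∘ R? y) (x⇒y , λ ¬s t → ¬s (≈.trans (≈.sym r) t)) ds)))
    where
    ds = deduplicate R? ys
    x⇒y : ∀ {z} → ¬ R x z → ¬ R y z
    x⇒y ¬s t = ¬s (≈.trans r t)
  ... | no ¬r = begin
    M x * (M y * ∏ (filter (¬? ∘ R? x) (filter (¬? ∘ R? y) ds)) M)
      ≡⟨ cong (λ p → M x * (M y * p)) (trans (cong (λ zs → ∏ zs M) (filter-comm (¬? ∘ R? x) (¬? ∘ R? y) ds))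
            (∏-filter (¬? ∘ R? y) M (filter (¬? ∘ R? x) ds))) ⟩
    M x * (M y * ∏ (filter (¬? ∘ R? x) ds) M′)
      ≡⟨ *-Properties.x∙yz≈y∙xz (M x) (M y) _ ⟩
    M y * (M x * ∏ (filter (¬? ∘ R? x) ds) M′)
      ≡⟨ cong (λ p → M y * (p * ∏ (filter (¬? ∘ R? x) ds) M′))
              (cong (if_then M x else 1) (dec-true (¬? (R? y x)) (¬r ∘ ≈.sym))) ⟨
    M y * (M′ x * ∏ (filter (¬? ∘ R? x) ds) M′)
      ≡⟨ cong (M y *_) (∏-remove-class M′ M′-resp ys (Any.tail ¬r x∼)) ⟩
    M y * ∏ ds M′
      ≡⟨ cong (M y *_) (∏-filter (¬? ∘ R? y) M ds) ⟨
    M y * ∏ (filter (¬? ∘ R? y) ds) M ∎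
    where
    open ≡-Reasoning
    ds = deduplicate R? ys
    -- Giving the class of `y` weight 1 has the effect of filtering it out, so the induction
    -- hypothesis applies to `ys` with a new weight.
    M′ : A → ℕ
    M′ z = if does (¬? (R? y z)) then M z else 1
    M′-resp : ∀ {u v} → R u v → M′ u ≡ M′ v
    M′-resp {u} {v} r = cong₂ (λ b m → if b then m else 1)
      (does-⇔ (mk⇔ (λ ¬s t → ¬s (≈.trans t (≈.sym r))) (λ ¬s t → ¬s (≈.trans t r)))
              (¬? (R? y u)) (¬? (R? y v)))
      (M-resp r)

∏-absorb : ∀ (f : A → ℕ) a {x} {xs} → x ∈ xs → a * f x ≡ f x → a * ∏ xs f ≡ ∏ xs f
∏-absorb f a {xs = x ∷ xs} (here refl) eq =
  trans (sym (*-assoc a (f x) _)) (cong (_* ∏ xs f) eq)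
∏-absorb f a {xs = x ∷ xs} (there p) eq =
  trans (*-Properties.x∙yz≈y∙xz a (f x) _) (cong (f x *_) (∏-absorb f a p eq))

∑-pick : ∀ {k} (f : Fin k → ℕ) d → ∑[ c ← allFin k ] (𝟙 (c Fin.≟ d) * f c) ≡ f d
∑-pick {suc k} f zero = begin
  ∑[ c ← allFin (suc k) ] (𝟙 (c Fin.≟ zero) * f c) ≡⟨ ∑-allFin-suc k _ ⟩
  1 * f zero + (∑[ c ← allFin k ] 0)               ≡⟨ cong₂ _+_ (*-identityˡ _) (∑-0 (allFin k)) ⟩
  f zero + 0                                       ≡⟨ +-identityʳ _ ⟩
  f zero                                           ∎
  where open ≡-Reasoning
∑-pick {suc k} f (suc d) = begin
  ∑[ c ← allFin (suc k) ] (𝟙 (c Fin.≟ suc d) * f c)    ≡⟨ ∑-allFin-suc k (λ c → 𝟙 (c Fin.≟ suc d) * f c) ⟩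
  ∑[ c ← allFin k ] (𝟙 (suc c Fin.≟ suc d) * f (suc c))
    ≡⟨ ∑-cong (allFin k) (λ c → cong (_* f (suc c))
         (𝟙-⇔ (suc c Fin.≟ suc d) (c Fin.≟ d) Fin.suc-injective (cong suc))) ⟩
  ∑[ c ← allFin k ] (𝟙 (c Fin.≟ d) * f (suc c))        ≡⟨ ∑-pick (f ∘ suc) d ⟩
  f (suc d)                                            ∎
  where open ≡-Reasoning

-- Colourings that are constant on equivalence classes

colourings : ∀ n k → List (Fin n → Fin k)
colourings zero    k = (λ ()) ∷ []
colourings (suc n) k = cartesianProductWith _∷ᶠ_ (allFin k) (colourings n k)

∑-colourings-suc : ∀ n k (h : (Fin (suc n) → Fin k) → ℕ) →
  ∑ (colourings (suc n) k) h ≡ ∑[ c ← allFin k ] ∑[ f ← colourings n k ] h (c ∷ᶠ f)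
∑-colourings-suc n k h = ∑-cartesianProductWith _∷ᶠ_ h (allFin k) (colourings n k)

Constant : ∀ {n k} → Rel (Fin n) 0ℓ → (Fin n → Fin k) → Set
Constant R f = ∀ u v → R u v → f u ≡ f v

constant? : ∀ {n k} {R : Rel (Fin n) 0ℓ} → Decidable R → U.Decidable (Constant {n} {k} R)
constant? R? f = Fin.all? (λ u → Fin.all? (λ v → R? u v →-dec f u Fin.≟ f v))

-- Such a colouring chooses one colour per class. By `absorb` the product over a class of several
-- vertices collapses to the factor of any one of them, while a class with a single vertex may carry
-- any weight. The induction removes vertex `zero`, whose colour is forced if a later vertex belongs
-- to its class and free otherwise.
∑-constant-colourings : ∀ {n k} {R : Rel (Fin n) 0ℓ} (R? : Decidable R) → IsEquivalence R →
  (ω : Fin n → Fin k → ℕ) →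
  (∀ {u v} → u ≢ v → R u v → ∀ c → ω u c * ω v c ≡ ω v c) →
  ∑[ f ← colourings n k ] (𝟙 (constant? R? f) * (∏[ v ← allFin n ] ω v (f v)))
    ≡ ∏[ r ← deduplicate R? (allFin n) ] ∑[ c ← allFin k ] ω r c
∑-constant-colourings {zero} R? ≈ ω absorb = refl
∑-constant-colourings {suc n} {k} {R} R? ≈ ω absorb = begin
  ∑[ f ← colourings (suc n) k ] (𝟙 (constant? R? f) * (∏[ v ← allFin (suc n) ] ω v (f v)))
    ≡⟨ ∑-colourings-suc n k _ ⟩
  ∑[ c ← allFin k ] ∑[ f ← colourings n k ]
    (𝟙 (constant? R? (c ∷ᶠ f)) * (∏[ v ← allFin (suc n) ] ω v ((c ∷ᶠ f) v)))
    ≡⟨ ∑-cong (allFin k) (λ c → ∑-cong (colourings n k) (λ f →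
         cong₂ _*_ (𝟙-cons c f) (∏-allFin-suc n (λ v → ω v ((c ∷ᶠ f) v))))) ⟩
  ∑[ c ← allFin k ] ∑[ f ← colourings n k ]
    (𝟙 (constant? R?′ f) * 𝟙 (agrees? c f) * (ω zero c * W f))
    ≡⟨ byCases (Fin.any? (λ v → R? zero (suc v))) ⟩
  M zero * ∏ (filter (¬? ∘ R? zero) (deduplicate R? (map suc (allFin n)))) M
    ≡⟨ cong (λ xs → ∏ (deduplicate R? xs) M) (allFin-suc n) ⟨
  ∏ (deduplicate R? (allFin (suc n))) M ∎
  where
  open ≡-Reasoning
  module ≈ = IsEquivalence ≈

  M : Fin (suc n) → ℕ
  M r = ∑[ c ← allFin k ] ω r c

  -- Absorption in both directions makes `ω u c` and `ω v c` equal to the same product.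
  M-resp : ∀ {u v} → R u v → M u ≡ M v
  M-resp {u} {v} r with u Fin.≟ v
  ... | yes refl = refl
  ... | no  u≢v  = ∑-cong (allFin k) (λ c →
    trans (sym (absorb (u≢v ∘ sym) (≈.sym r) c)) (trans (*-comm (ω v c) (ω u c)) (absorb u≢v r c)))

  R?′ : Decidable (R on suc)
  R?′ u v = R? (suc u) (suc v)

  W : (Fin n → Fin k) → ℕ
  W f = ∏[ v ← allFin n ] ω (suc v) (f v)

  agrees? : ∀ c f → Dec (∀ v → R zero (suc v) → c ≡ f v)
  agrees? c f = Fin.all? (λ v → R? zero (suc v) →-dec c Fin.≟ f v)

  𝟙-cons : ∀ c f → 𝟙 (constant? R? (c ∷ᶠ f)) ≡ 𝟙 (constant? R?′ f) * 𝟙 (agrees? c f)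
  𝟙-cons c f = trans
    (𝟙-⇔ (constant? R? (c ∷ᶠ f)) (constant? R?′ f ×-dec agrees? c f)
      (λ const → (λ u v → const (suc u) (suc v)) , (λ v → const zero (suc v)))
      (λ { (const , agrees) zero    zero    r → refl
         ; (const , agrees) zero    (suc v) r → agrees v r
         ; (const , agrees) (suc u) zero    r → sym (agrees u (≈.sym r))
         ; (const , agrees) (suc u) (suc v) r → const u v r }))
    (𝟙-× (constant? R?′ f) (agrees? c f))

  ih : ∑[ f ← colourings n k ] (𝟙 (constant? R?′ f) * W f)
       ≡ ∏ (deduplicate R? (map suc (allFin n))) M
  ih = begin
    ∑[ f ← colourings n k ] (𝟙 (constant? R?′ f) * W f)
      ≡⟨ ∑-constant-colourings R?′ (On.isEquivalence suc ≈) (ω ∘ suc)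
           (λ u≢v → absorb (u≢v ∘ Fin.suc-injective)) ⟩
    ∏ (deduplicate R?′ (allFin n)) (M ∘ suc)
      ≡⟨ ∏-map suc M (deduplicate R?′ (allFin n)) ⟨
    ∏ (map suc (deduplicate R?′ (allFin n))) M
      ≡⟨ cong (λ xs → ∏ xs M) (deduplicate-map R? suc (allFin n)) ⟨
    ∏ (deduplicate R? (map suc (allFin n))) M ∎

  shuffle : ∀ a b c d → a * b * (c * d) ≡ b * (c * (a * d))
  shuffle = solve-∀

  byCases : Dec (∃ λ v → R zero (suc v)) →
    ∑[ c ← allFin k ] ∑[ f ← colourings n k ]
      (𝟙 (constant? R?′ f) * 𝟙 (agrees? c f) * (ω zero c * W f))
    ≡ M zero * ∏ (filter (¬? ∘ R? zero) (deduplicate R? (map suc (allFin n)))) M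
  byCases (yes (u , 0∼u)) = begin
    ∑[ c ← allFin k ] ∑[ f ← colourings n k ]
      (𝟙 (constant? R?′ f) * 𝟙 (agrees? c f) * (ω zero c * W f))
      ≡⟨ ∑-swap _ (allFin k) (colourings n k) ⟩
    ∑[ f ← colourings n k ] ∑[ c ← allFin k ]
      (𝟙 (constant? R?′ f) * 𝟙 (agrees? c f) * (ω zero c * W f))
      ≡⟨ ∑-cong (colourings n k) forced ⟩
    ∑[ f ← colourings n k ] (𝟙 (constant? R?′ f) * W f)
      ≡⟨ ih ⟩
    ∏ (deduplicate R? (map suc (allFin n))) M
      -- `deduplicate` keeps `zero` in place of the later representative of its class.
      ≡⟨ ∏-remove-class R? ≈ M M-resp (map suc (allFin n))
           (Any.map (λ { refl → 0∼u }) (∈-map⁺ suc (∈-allFin u))) ⟨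
    M zero * ∏ (filter (¬? ∘ R? zero) (deduplicate R? (map suc (allFin n)))) M ∎
    where
    forced : ∀ f → ∑[ c ← allFin k ] (𝟙 (constant? R?′ f) * 𝟙 (agrees? c f) * (ω zero c * W f))
                   ≡ 𝟙 (constant? R?′ f) * W f
    forced f = begin
      ∑[ c ← allFin k ] (𝟙 (constant? R?′ f) * 𝟙 (agrees? c f) * (ω zero c * W f))
        -- When `f` is constant on classes, agreeing with the whole class of `zero` is the same as
        -- agreeing with `u`, so only the colour `f u` survives.
        ≡⟨ ∑-cong (allFin k) (λ c → trans (*-assoc (𝟙 (constant? R?′ f)) _ _)
             (𝟙-*-cong (constant? R?′ f) (λ const →
               cong (_* (ω zero c * W f)) (𝟙-⇔ (agrees? c f) (c Fin.≟ f u)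
                 (λ agrees → agrees u 0∼u)
                 (λ { refl v 0∼v → const u v (≈.trans (≈.sym 0∼u) 0∼v) }))))) ⟩
      ∑[ c ← allFin k ] (𝟙 (constant? R?′ f) * (𝟙 (c Fin.≟ f u) * (ω zero c * W f)))
        ≡⟨ ∑-*ˡ (𝟙 (constant? R?′ f)) _ (allFin k) ⟩
      𝟙 (constant? R?′ f) * (∑[ c ← allFin k ] (𝟙 (c Fin.≟ f u) * (ω zero c * W f)))
        ≡⟨ cong (𝟙 (constant? R?′ f) *_) (∑-pick (λ c → ω zero c * W f) (f u)) ⟩
      𝟙 (constant? R?′ f) * (ω zero (f u) * W f)
        ≡⟨ cong (𝟙 (constant? R?′ f) *_)
             (∏-absorb _ (ω zero (f u)) (∈-allFin u) (absorb (λ ()) 0∼u (f u))) ⟩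
      𝟙 (constant? R?′ f) * W f ∎
  byCases (no ¬0∼) = begin
    ∑[ c ← allFin k ] ∑[ f ← colourings n k ]
      (𝟙 (constant? R?′ f) * 𝟙 (agrees? c f) * (ω zero c * W f))
      ≡⟨ ∑-cong (allFin k) (λ c → ∑-cong (colourings n k) (λ f → free c f)) ⟩
    ∑[ c ← allFin k ] ∑[ f ← colourings n k ] (ω zero c * (𝟙 (constant? R?′ f) * W f))
      ≡⟨ ∑-cong (allFin k) (λ c → ∑-*ˡ (ω zero c) _ (colourings n k)) ⟩
    ∑[ c ← allFin k ] (ω zero c * (∑[ f ← colourings n k ] (𝟙 (constant? R?′ f) * W f)))
      ≡⟨ ∑-*ʳ (ω zero) _ (allFin k) ⟩
    M zero * (∑[ f ← colourings n k ] (𝟙 (constant? R?′ f) * W f))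
      ≡⟨ cong (M zero *_) ih ⟩
    M zero * ∏ (deduplicate R? (map suc (allFin n))) M
      ≡⟨ cong (λ xs → M zero * ∏ xs M) (filter-all (¬? ∘ R? zero)
           (Allₚ.deduplicate⁺ R? (Allₚ.map⁺ (All.universal (λ v 0∼v → ¬0∼ (v , 0∼v)) (allFin n))))) ⟨
    M zero * ∏ (filter (¬? ∘ R? zero) (deduplicate R? (map suc (allFin n)))) M ∎
    where
    free : ∀ c f → 𝟙 (constant? R?′ f) * 𝟙 (agrees? c f) * (ω zero c * W f)
                   ≡ ω zero c * (𝟙 (constant? R?′ f) * W f)
    free c f = begin
      𝟙 (constant? R?′ f) * 𝟙 (agrees? c f) * (ω zero c * W f)
        ≡⟨ cong (λ p → 𝟙 (constant? R?′ f) * p * (ω zero c * W f))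
             (𝟙-yes (agrees? c f) (λ v 0∼v → contradiction (v , 0∼v) ¬0∼)) ⟩
      𝟙 (constant? R?′ f) * 1 * (ω zero c * W f)
        ≡⟨ shuffle (𝟙 (constant? R?′ f)) 1 (ω zero c) (W f) ⟩
      1 * (ω zero c * (𝟙 (constant? R?′ f) * W f))
        ≡⟨ *-identityˡ _ ⟩
      ω zero c * (𝟙 (constant? R?′ f) * W f) ∎

-- Partition functions of complete graphs

∏-edges : ∀ n (h : Fin n → Fin n → ℕ) →
  ∏[ e ← edges (K n) ] h (proj₁ e) (proj₂ e)
    ≡ ∏[ u ← allFin n ] ∏[ v ← allFin n ]
        (if does ((u Fin.<? v) ×-dec Graph.adj? (K n) u v) then h u v else 1)
∏-edges n h =
  trans (∏-filter (λ e → (proj₁ e Fin.<? proj₂ e) ×-dec Graph.adj? (K n) (proj₁ e) (proj₂ e))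
                  (λ e → h (proj₁ e) (proj₂ e)) (cartesianProduct (allFin n) (allFin n)))
        (∏-cartesianProductWith _,_ _ (allFin n) (allFin n))

∏-edges-suc : ∀ n (h : Fin (suc n) → Fin (suc n) → ℕ) →
  ∏[ e ← edges (K (suc n)) ] h (proj₁ e) (proj₂ e)
    ≡ (∏[ v ← allFin n ] h zero (suc v)) * (∏[ e ← edges (K n) ] h (suc (proj₁ e)) (suc (proj₂ e)))
∏-edges-suc n h = begin
  ∏[ e ← edges (K (suc n)) ] h (proj₁ e) (proj₂ e)
    ≡⟨ ∏-edges (suc n) h ⟩
  ∏[ u ← allFin (suc n) ] ∏[ v ← allFin (suc n) ] G u v
    ≡⟨ ∏-cong (allFin (suc n)) (λ u → ∏-allFin-suc n (G u)) ⟩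
  ∏[ u ← allFin (suc n) ] (G u zero * (∏[ v ← allFin n ] G u (suc v)))
    ≡⟨ ∏-allFin-suc n (λ u → G u zero * (∏[ v ← allFin n ] G u (suc v))) ⟩
  -- The first 1 is the loop at `zero`; the others are the pairs `(suc u , zero)`, which are in the
  -- wrong order to be stored as edges.
  1 * (∏[ v ← allFin n ] h zero (suc v)) * (∏[ u ← allFin n ] (1 * (∏[ v ← allFin n ] G (suc u) (suc v))))
    ≡⟨ cong₂ _*_ (*-identityˡ (∏[ v ← allFin n ] h zero (suc v)))
                 (∏-cong (allFin n) (λ u → *-identityˡ (∏[ v ← allFin n ] G (suc u) (suc v)))) ⟩
  (∏[ v ← allFin n ] h zero (suc v)) * (∏[ u ← allFin n ] ∏[ v ← allFin n ] G (suc u) (suc v))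
    ≡⟨ cong ((∏[ v ← allFin n ] h zero (suc v)) *_) (∏-edges n (λ u v → h (suc u) (suc v))) ⟨
  (∏[ v ← allFin n ] h zero (suc v)) * (∏[ e ← edges (K n) ] h (suc (proj₁ e)) (suc (proj₂ e))) ∎
  where
  open ≡-Reasoning
  G : Fin (suc n) → Fin (suc n) → ℕ
  G u v = if does ((u Fin.<? v) ×-dec Graph.adj? (K (suc n)) u v) then h u v else 1

module _ {k} (β : Fin k → Fin k → ℕ) where

  partitionFunction : ℕ → (Fin k → ℕ) → ℕ
  partitionFunction n α = ∑[ f ← colourings n k ]
    ((∏[ v ← allFin n ] α (f v)) * (∏[ e ← edges (K n) ] β (f (proj₁ e)) (f (proj₂ e))))

  -- In a complete graph vertex `zero` is adjacent to every other vertex, so the edge factors at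
  -- `zero` depend only on the colour of the other end and merge into the vertex weights.
  partitionFunction-suc : ∀ n α → partitionFunction (suc n) α
    ≡ ∑[ c ← allFin k ] (α c * partitionFunction n (λ d → α d * β c d))
  partitionFunction-suc n α = begin
    partitionFunction (suc n) α
      ≡⟨ ∑-colourings-suc n k _ ⟩
    ∑[ c ← allFin k ] ∑[ f ← colourings n k ]
      ((∏[ v ← allFin (suc n) ] α ((c ∷ᶠ f) v))
        * (∏[ e ← edges (K (suc n)) ] β ((c ∷ᶠ f) (proj₁ e)) ((c ∷ᶠ f) (proj₂ e))))
      ≡⟨ ∑-cong (allFin k) (λ c → ∑-cong (colourings n k) (λ f → split c f)) ⟩
    ∑[ c ← allFin k ] ∑[ f ← colourings n k ]
      (α c * ((∏[ v ← allFin n ] (α (f v) * β c (f v)))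
        * (∏[ e ← edges (K n) ] β (f (proj₁ e)) (f (proj₂ e)))))
      ≡⟨ ∑-cong (allFin k) (λ c → ∑-*ˡ (α c) _ (colourings n k)) ⟩
    ∑[ c ← allFin k ] (α c * partitionFunction n (λ d → α d * β c d)) ∎
    where
    open ≡-Reasoning
    shuffle : ∀ a b c d → a * b * (c * d) ≡ a * (b * c * d)
    shuffle = solve-∀
    split : ∀ c f →
      (∏[ v ← allFin (suc n) ] α ((c ∷ᶠ f) v))
        * (∏[ e ← edges (K (suc n)) ] β ((c ∷ᶠ f) (proj₁ e)) ((c ∷ᶠ f) (proj₂ e)))
      ≡ α c * ((∏[ v ← allFin n ] (α (f v) * β c (f v)))
        * (∏[ e ← edges (K n) ] β (f (proj₁ e)) (f (proj₂ e))))
    split c f = begin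
      (∏[ v ← allFin (suc n) ] α ((c ∷ᶠ f) v))
        * (∏[ e ← edges (K (suc n)) ] β ((c ∷ᶠ f) (proj₁ e)) ((c ∷ᶠ f) (proj₂ e)))
        ≡⟨ cong₂ _*_ (∏-allFin-suc n (λ v → α ((c ∷ᶠ f) v)))
                     (∏-edges-suc n (λ u v → β ((c ∷ᶠ f) u) ((c ∷ᶠ f) v))) ⟩
      α c * (∏[ v ← allFin n ] α (f v)) * ((∏[ v ← allFin n ] β c (f v)) * E)
        ≡⟨ shuffle (α c) _ _ E ⟩
      α c * ((∏[ v ← allFin n ] α (f v)) * (∏[ v ← allFin n ] β c (f v)) * E)
        ≡⟨ cong (λ p → α c * (p * E)) (∏-* (λ v → α (f v)) (λ v → β c (f v)) (allFin n)) ⟨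
      α c * ((∏[ v ← allFin n ] (α (f v) * β c (f v))) * E) ∎
      where
      E = ∏[ e ← edges (K n) ] β (f (proj₁ e)) (f (proj₂ e))

-- Congruence modulo `suc m`, and periodicity of partition functions by the pigeonhole principle.

module Congruence (m : ℕ) where

  infix 4 _≋_
  -- As a record, so that `a` and `b` can be recovered by unification, which a bare equation between
  -- remainders would not allow.
  record _≋_ (a b : ℕ) : Set where
    constructor ≋-intro
    field %-≡ : a % suc m ≡ b % suc m

  ≋-setoid : Setoid 0ℓ 0ℓ
  ≋-setoid = record
    { _≈_           = _≋_
    ; isEquivalence = record
      { refl  = ≋-intro refl
      ; sym   = λ (≋-intro p) → ≋-intro (sym p)
      ; trans = λ (≋-intro p) (≋-intro q) → ≋-intro (trans p q)
      }
    }

  open Setoid ≋-setoid public using () renaming (refl to ≋-refl)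
  module ≋-Reasoning = SetoidReasoning ≋-setoid

  ≡⇒≋ : ∀ {a b} → a ≡ b → a ≋ b
  ≡⇒≋ refl = ≋-refl

  +-≋ : ∀ {a a′ b b′} → a ≋ a′ → b ≋ b′ → a + b ≋ a′ + b′
  +-≋ {a} {a′} {b} {b′} (≋-intro p) (≋-intro q) = ≋-intro
    (trans (%-distribˡ-+ a b (suc m))
           (trans (cong₂ (λ r s → (r + s) % suc m) p q) (sym (%-distribˡ-+ a′ b′ (suc m)))))

  *-≋ : ∀ {a a′ b b′} → a ≋ a′ → b ≋ b′ → a * b ≋ a′ * b′
  *-≋ {a} {a′} {b} {b′} (≋-intro p) (≋-intro q) = ≋-intro
    (trans (%-distribˡ-* a b (suc m))
           (trans (cong₂ (λ r s → (r * s) % suc m) p q) (sym (%-distribˡ-* a′ b′ (suc m)))))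

  ∑-≋ : ∀ {f g : A → ℕ} xs → (∀ x → f x ≋ g x) → ∑ xs f ≋ ∑ xs g
  ∑-≋ []       eq = ≋-refl
  ∑-≋ (x ∷ xs) eq = +-≋ (eq x) (∑-≋ xs eq)

  ∏-≋ : ∀ {f g : A → ℕ} xs → (∀ x → f x ≋ g x) → ∏ xs f ≋ ∏ xs g
  ∏-≋ []       eq = ≋-refl
  ∏-≋ (x ∷ xs) eq = *-≋ (eq x) (∏-≋ xs eq)

  ≋⇒∣ : ∀ a b → a ≋ b → ℤ.+ suc m ℤ.∣ (ℤ.+ a ℤ.- ℤ.+ b)
  -- Integer divisibility is divisibility of absolute values. The equal remainders cancel, so the
  -- cofactor is the distance between the quotients.
  ≋⇒∣ a b (≋-intro eq) = divides ∣ a / suc m - b / suc m ∣ (begin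
    ℤ.∣ ℤ.+ a ℤ.- ℤ.+ b ∣
      ≡⟨ cong ℤ.∣_∣ (ℤ.m-n≡m⊖n a b) ⟩
    ℤ.∣ a ℤ.⊖ b ∣
      ≡⟨ ∣⊖∣≡∣-∣ a b ⟩
    ∣ a - b ∣
      ≡⟨ cong₂ ∣_-_∣ (m≡m%n+[m/n]*n a (suc m)) (m≡m%n+[m/n]*n b (suc m)) ⟩
    ∣ a % suc m + a / suc m * suc m - b % suc m + b / suc m * suc m ∣
      ≡⟨ cong (λ r → ∣ a % suc m + a / suc m * suc m - r + b / suc m * suc m ∣) eq ⟨
    ∣ a % suc m + a / suc m * suc m - a % suc m + b / suc m * suc m ∣
      ≡⟨ ∣m+n-m+o∣≡∣n-o∣ (a % suc m) _ _ ⟩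
    ∣ a / suc m * suc m - b / suc m * suc m ∣
      ≡⟨ *-distribʳ-∣-∣ (suc m) (a / suc m) (b / suc m) ⟨
    ∣ a / suc m - b / suc m ∣ * suc m ∎)
    where
    open ≡-Reasoning
    ∣⊖∣≡∣-∣ : ∀ a b → ℤ.∣ a ℤ.⊖ b ∣ ≡ ∣ a - b ∣
    ∣⊖∣≡∣-∣ zero    zero    = refl
    ∣⊖∣≡∣-∣ zero    (suc b) = refl
    ∣⊖∣≡∣-∣ (suc a) zero    = refl
    ∣⊖∣≡∣-∣ (suc a) (suc b) = trans (cong ℤ.∣_∣ (ℤ.[1+m]⊖[1+n]≡m⊖n a b)) (∣⊖∣≡∣-∣ a b)

  module _ {k} (β : Fin k → Fin k → ℕ) where
    private
      Z = partitionFunction β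

      -- Codes the vector of remainders of `α` as a single number, so that these vectors form a
      -- finite type.
      residue : (Fin k → ℕ) → Fin (suc m ^ k)
      residue α = funToFin (λ c → α c mod suc m)

      representative : Fin (suc m ^ k) → Fin k → ℕ
      representative i c = toℕ (finToFun i c)

      representative-≋ : ∀ α c → representative (residue α) c ≋ α c
      representative-≋ α c = ≋-intro (trans
        (cong (λ i → toℕ i % suc m) (Fin.finToFun-funToFin (λ c → α c mod suc m) c))
        (trans (cong (_% suc m) (Fin.toℕ-fromℕ< (m%n<n (α c) (suc m)))) (m%n%n≡m%n (α c) (suc m))))

      Z-cong : ∀ n α α′ → (∀ c → α c ≋ α′ c) → Z n α ≋ Z n α′
      Z-cong zero    α α′ eq = ≋-refl
      Z-cong (suc n) α α′ eq = begin
        Z (suc n) α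
          ≡⟨ partitionFunction-suc β n α ⟩
        ∑[ c ← allFin k ] (α c * Z n (λ d → α d * β c d))
          ≈⟨ ∑-≋ (allFin k) (λ c → *-≋ (eq c) (Z-cong n _ _ (λ d → *-≋ (eq d) (≋-refl {β c d})))) ⟩
        ∑[ c ← allFin k ] (α′ c * Z n (λ d → α′ d * β c d))
          ≡⟨ partitionFunction-suc β n α′ ⟨
        Z (suc n) α′ ∎
        where open ≋-Reasoning

      -- The table of remainders of `Z n` at all reduced weight vectors, again coded as a single
      -- number.
      state : ℕ → Fin (suc m ^ (suc m ^ k))
      state n = funToFin (λ i → Z n (representative i) mod suc m)

      -- By `Z-cong` every `α` may be replaced by its reduced representative, and there the two
      -- tables have the same entry.
      state-injective : ∀ i j → state i ≡ state j → ∀ α → Z i α ≋ Z j α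
      state-injective i j eq α = begin
        Z i α ≈⟨ Z-cong i α̂ α (representative-≋ α) ⟨
        Z i α̂ ≈⟨ ≋-intro (trans (sym (decode i)) (trans (cong (λ s → toℕ (finToFun s r)) eq) (decode j))) ⟩
        Z j α̂ ≈⟨ Z-cong j α̂ α (representative-≋ α) ⟩
        Z j α ∎
        where
        open ≋-Reasoning
        r = residue α
        α̂ = representative r
        decode : ∀ n → toℕ (finToFun (state n) r) ≡ Z n α̂ % suc m
        decode n = trans (cong toℕ (Fin.finToFun-funToFin (λ l → Z n (representative l) mod suc m) r))
                         (Fin.toℕ-fromℕ< (m%n<n (Z n α̂) (suc m)))

      -- The recursion has the same coefficients at every index. The agreement is required for all
      -- weights because the recursion changes them.
      Z-shift : ∀ i j → (∀ α → Z i α ≋ Z j α) → ∀ d α → Z (d + i) α ≋ Z (d + j) α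
      Z-shift i j eq zero    α = eq α
      Z-shift i j eq (suc d) α = begin
        Z (suc d + i) α
          ≡⟨ partitionFunction-suc β (d + i) α ⟩
        ∑[ c ← allFin k ] (α c * Z (d + i) (λ d → α d * β c d))
          ≈⟨ ∑-≋ (allFin k) (λ c → *-≋ (≋-refl {α c}) (Z-shift i j eq d (λ d → α d * β c d))) ⟩
        ∑[ c ← allFin k ] (α c * Z (d + j) (λ d → α d * β c d))
          ≡⟨ partitionFunction-suc β (d + j) α ⟨
        Z (suc d + j) α ∎
        where open ≋-Reasoning

    partitionFunction-periodic : ∀ α (s : ℕ → ℕ) → (∀ n → s n ≋ partitionFunction β n α) →
                                 UltimatelyPeriodicMod (suc m) (λ n → ℤ.+ s n)
    partitionFunction-periodic α s s≋Z
      -- There is one more index than there are states, so two indices share a state.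
      with i′ , j′ , i<j , eq ← Fin.pigeonhole (n<1+n (suc m ^ (suc m ^ k))) (state ∘ toℕ)
      -- The threshold is `suc i` instead of `i` because it has to be at least 1.
      = suc i , j ∸ i , s≤s z≤n , m<n⇒0<n∸m i<j , λ n i<n → ≋⇒∣ (s (n + (j ∸ i))) (s n) (begin
          s (n + (j ∸ i))   ≈⟨ s≋Z (n + (j ∸ i)) ⟩
          Z (n + (j ∸ i)) α ≡⟨ cong (λ l → Z l α) (n+p n (<⇒≤ i<n)) ⟩
          Z (n ∸ i + j) α   ≈⟨ Z-shift i j (state-injective i j eq) (n ∸ i) α ⟨
          Z (n ∸ i + i) α   ≡⟨ cong (λ l → Z l α) (m∸n+n≡m (<⇒≤ i<n)) ⟩
          Z n α             ≈⟨ s≋Z n ⟨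
          s n               ∎)
      where
      open ≋-Reasoning
      i = toℕ i′
      j = toℕ j′
      n+p : ∀ n → i ≤ n → n + (j ∸ i) ≡ n ∸ i + j
      n+p n i≤n = trans (cong (_+ (j ∸ i)) (sym (m∸n+n≡m i≤n)))
        (trans (+-assoc (n ∸ i) i (j ∸ i)) (cong (n ∸ i +_) (m+[n∸m]≡n (<⇒≤ i<j))))

-- Counting in lists.

∑-1 : ∀ (xs : List A) → ∑[ _ ← xs ] 1 ≡ length xs
∑-1 []       = refl
∑-1 (x ∷ xs) = cong suc (∑-1 xs)

∑-allFin-1 : ∀ n → ∑[ _ ← allFin n ] 1 ≡ n
∑-allFin-1 n = trans (∑-1 (allFin n)) (length-tabulate {n = n} id)

∑-allFin-+ : ∀ p q (f : Fin (p + q) → ℕ) →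
  ∑ (allFin (p + q)) f ≡ ∑ (allFin p) (f ∘ (_↑ˡ q)) + ∑ (allFin q) (f ∘ (p ↑ʳ_))
∑-allFin-+ zero    q f = refl
∑-allFin-+ (suc p) q f = begin
  ∑ (allFin (suc p + q)) f
    ≡⟨ ∑-allFin-suc (p + q) f ⟩
  f zero + ∑ (allFin (p + q)) (f ∘ suc)
    ≡⟨ cong (f zero +_) (∑-allFin-+ p q (f ∘ suc)) ⟩
  f zero + (∑ (allFin p) (λ i → f (suc (i ↑ˡ q))) + r)
    ≡⟨ +-assoc (f zero) _ r ⟨
  f zero + ∑ (allFin p) (λ i → f (suc (i ↑ˡ q))) + r
    ≡⟨ cong (_+ r) (∑-allFin-suc p (λ i → f (i ↑ˡ q))) ⟨
  ∑ (allFin (suc p)) (λ i → f (i ↑ˡ q)) + r ∎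
  where
  open ≡-Reasoning
  r = ∑ (allFin q) (λ j → f (suc (p ↑ʳ j)))

-- Applied to the list of components, with those that have an edge as the marked ones, this produces
-- the exponents `κ` and `c`.
∏-marked : ∀ {P : Pred A 0ℓ} (P? : U.Decidable P) a t xs →
  ∏[ x ← xs ] (a * (if does (P? x) then t else 1)) ≡ a ^ length xs * t ^ length (filter P? xs)
∏-marked P? a t xs = trans (∏-* (λ _ → a) _ xs)
  (cong₂ _*_ (∏-const a xs) (trans (sym (∏-filter P? (λ _ → t) xs)) (∏-const t (filter P? xs))))

-- Deleting from `ys` all partners of the head removes at least one element, and the remaining `xs`
-- keep theirs because no partner is shared.
length-≤ : ∀ {R : A → B → Set} → (∀ x y → Dec (R x y)) → ∀ {xs} ys →
  AllPairs (λ x x′ → ∀ y → R x y → ¬ R x′ y) xs → All (λ x → Any (R x) ys) xs → length xs ≤ length ys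
length-≤ R? ys []                []         = z≤n
length-≤ R? ys (x-alone ∷ alone) (x∼ ∷ ∼ys) = ≤-trans
  (s≤s (length-≤ R? (filter (¬? ∘ R? _) ys) alone
    (All.zipWith (λ (disjoint , x′∼) → let y , y∈ys , x′∼y = find x′∼ in
                   lose (∈-filter⁺ (¬? ∘ R? _) y∈ys (λ x∼y → disjoint y x∼y x′∼y)) x′∼y)
                 (x-alone , ∼ys))))
  (filter-notAll (¬? ∘ R? _) ys (Any.map (λ x∼y ¬x∼y → ¬x∼y x∼y) x∼))

deduplicate-AllPairs : ∀ {R : Rel A 0ℓ} (R? : Decidable R) xs →
                       AllPairs (λ x y → ¬ R x y) (deduplicate R? xs)
deduplicate-AllPairs R? []       = []
deduplicate-AllPairs R? (x ∷ xs) =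
  Allₚ.all-filter (¬? ∘ R? x) (deduplicate R? xs) ∷
  AllPairsₚ.filter⁺ (¬? ∘ R? x) (deduplicate-AllPairs R? xs)

-- Members of `subsets`.

∈-subsets⇒⊆ : ∀ (xs : List A) {ys} → ys ∈ subsets xs → ∀ {y} → y ∈ ys → y ∈ xs
∈-subsets⇒⊆ []       (here refl) ()
∈-subsets⇒⊆ (x ∷ xs) p y∈ys with ∈-++⁻ (map (x ∷_) (subsets xs)) p
... | inj₂ q = there (∈-subsets⇒⊆ xs q y∈ys)
... | inj₁ q with ∈-map⁻ (x ∷_) q
∈-subsets⇒⊆ (x ∷ xs) p (here eq)    | inj₁ q | zs , r , refl = here eq
∈-subsets⇒⊆ (x ∷ xs) p (there y∈zs) | inj₁ q | zs , r , refl = there (∈-subsets⇒⊆ xs r y∈zs)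

module _ {n : ℕ} where
  open DecMembership (Fin._≟_ {n}) using (_∈?_)

  private
    ∉-head : ∀ {x : Fin n} {xs v} → All (x ≢_) xs → v ∈ xs → v ≢ x
    ∉-head x∉xs v∈xs v≡x = All.lookup x∉xs v∈xs (sym v≡x)

  -- A member of `subsets xs` lists its elements in the order of `xs`, so filtering returns that
  -- very list and not merely a permutation of it.
  filter-∈-subset : ∀ {xs} → Unique xs → ∀ {ys} → ys ∈ subsets xs → filter (_∈? ys) xs ≡ ys
  filter-∈-subset {[]}     []             (here refl) = refl
  filter-∈-subset {x ∷ xs} (x∉xs ∷ uniq) {ys} p with ∈-++⁻ (map (x ∷_) (subsets xs)) p
  ... | inj₂ q = trans
    (filter-reject (_∈? ys) (λ x∈ys → All.lookup x∉xs (∈-subsets⇒⊆ xs q x∈ys) refl))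
    (filter-∈-subset uniq q)
  ... | inj₁ q with zs , r , refl ← ∈-map⁻ (x ∷_) q = trans
    (filter-accept (_∈? (x ∷ zs)) {xs = xs} (here refl))
    (cong (x ∷_) (trans
      (filter-cong (_∈? (x ∷ zs)) (_∈? zs) xs (λ {v} v∈xs →
        does-⇔ (mk⇔ (Any.tail (∉-head x∉xs v∈xs)) there) (v ∈? (x ∷ zs)) (v ∈? zs)))
      (filter-∈-subset uniq r)))

  module _ {P : Pred (Fin n) 0ℓ} (P? : U.Decidable P) where

    Agrees : List (Fin n) → Pred (Fin n) 0ℓ
    Agrees W v = (v ∈ W → P v) × (P v → v ∈ W)

    agrees? : ∀ W → U.Decidable (Agrees W)
    agrees? W v = (v ∈? W →-dec P? v) ×-dec (P? v →-dec v ∈? W)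

    -- Exactly one summand survives: the subset of the elements satisfying P.
    ∑-subsets-agreeing : ∀ X {xs} → Unique xs →
      ∑[ W ← subsets xs ] (X ^ length W * 𝟙 (All.all? (agrees? W) xs))
        ≡ ∏[ v ← xs ] (if does (P? v) then X else 1)
    ∑-subsets-agreeing X {[]}     []            = refl
    ∑-subsets-agreeing X {x ∷ xs} (x∉xs ∷ uniq) = begin
      ∑[ W ← map (x ∷_) (subsets xs) ++ subsets xs ] (X ^ length W * 𝟙 (All.all? (agrees? W) (x ∷ xs)))
        ≡⟨ trans (∑-++ _ (map (x ∷_) (subsets xs)) (subsets xs))
             (cong (_+ (∑[ W ← subsets xs ] (X ^ length W * 𝟙 (All.all? (agrees? W) (x ∷ xs)))))
               (∑-map (x ∷_) _ (subsets xs))) ⟩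
      (∑[ W ← subsets xs ] (X * X ^ length W * 𝟙 (All.all? (agrees? (x ∷ W)) (x ∷ xs))))
        + (∑[ W ← subsets xs ] (X ^ length W * 𝟙 (All.all? (agrees? W) (x ∷ xs))))
        ≡⟨ cong₂ _+_
             (∑-cong (subsets xs) (λ W → trans
               (cong (X * X ^ length W *_) (𝟙-with W)) (*-Properties.interchange X (X ^ length W) (𝟙 (P? x)) _)))
             (∑-cong-∈ (subsets xs) (λ {W} W∈ → trans
               (cong (X ^ length W *_) (𝟙-without W∈)) (*-Properties.x∙yz≈y∙xz (X ^ length W) (𝟙 (¬? (P? x))) _))) ⟩
      (∑[ W ← subsets xs ] (X * 𝟙 (P? x) * (X ^ length W * 𝟙 (All.all? (agrees? W) xs))))
        + (∑[ W ← subsets xs ] (𝟙 (¬? (P? x)) * (X ^ length W * 𝟙 (All.all? (agrees? W) xs))))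
        ≡⟨ cong₂ _+_ (∑-*ˡ (X * 𝟙 (P? x)) _ (subsets xs)) (∑-*ˡ (𝟙 (¬? (P? x))) _ (subsets xs)) ⟩
      X * 𝟙 (P? x) * s + 𝟙 (¬? (P? x)) * s
        ≡⟨ *-distribʳ-+ s (X * 𝟙 (P? x)) _ ⟨
      (X * 𝟙 (P? x) + 𝟙 (¬? (P? x))) * s
        ≡⟨ cong₂ _*_ weight (∑-subsets-agreeing X uniq) ⟩
      (if does (P? x) then X else 1) * (∏[ v ← xs ] (if does (P? v) then X else 1)) ∎
      where
      open ≡-Reasoning
      s = ∑[ W ← subsets xs ] (X ^ length W * 𝟙 (All.all? (agrees? W) xs))


      weight : X * 𝟙 (P? x) + 𝟙 (¬? (P? x)) ≡ (if does (P? x) then X else 1)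
      weight with does (P? x)
      ... | true  = trans (+-identityʳ _) (*-identityʳ X)
      ... | false = cong (_+ 1) (*-zeroʳ X)

      𝟙-with : ∀ W → 𝟙 (All.all? (agrees? (x ∷ W)) (x ∷ xs)) ≡ 𝟙 (P? x) * 𝟙 (All.all? (agrees? W) xs)
      𝟙-with W = trans
        (𝟙-⇔ (All.all? (agrees? (x ∷ W)) (x ∷ xs)) (P? x ×-dec All.all? (agrees? W) xs)
          (λ { ((to , _) ∷ ags) → to (here refl) , All.tabulate (λ v∈xs →
                 let to , from = All.lookup ags v∈xs in
                 (λ v∈W → to (there v∈W)) , (λ p → Any.tail (∉-head x∉xs v∈xs) (from p))) })
          (λ (p , ags) → ((λ _ → p) , (λ _ → here refl)) ∷ All.tabulate (λ v∈xs →
                 let to , from = All.lookup ags v∈xs in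
                 (λ v∈ → to (Any.tail (∉-head x∉xs v∈xs) v∈)) , (λ p → there (from p)))))
        (𝟙-× (P? x) (All.all? (agrees? W) xs))

      𝟙-without : ∀ {W} → W ∈ subsets xs →
        𝟙 (All.all? (agrees? W) (x ∷ xs)) ≡ 𝟙 (¬? (P? x)) * 𝟙 (All.all? (agrees? W) xs)
      𝟙-without {W} W∈ = trans
        (𝟙-⇔ (All.all? (agrees? W) (x ∷ xs)) (¬? (P? x) ×-dec All.all? (agrees? W) xs)
          (λ { ((_ , from) ∷ ags) → (λ p → x∉W (from p)) , ags })
          (λ (¬p , ags) → ((λ x∈W → contradiction x∈W x∉W) , (λ p → contradiction p ¬p)) ∷ ags))
        (𝟙-× (¬? (P? x)) (All.all? (agrees? W) xs))
        where
        x∉W : x ∉ W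
        x∉W x∈W = All.lookup x∉xs (∈-subsets⇒⊆ xs W∈ x∈W) refl

-- Colourings and connected components

module _ {n} {F : List (Edge n)} where

  connected⇒covered : ∀ {u v} → u ≢ v → Connected F u v → Covered F u
  connected⇒covered u≢v ε            = contradiction refl u≢v
  connected⇒covered u≢v (fwd e∈ ◅ _) = Any.map (λ { refl → inj₁ refl }) e∈
  connected⇒covered u≢v (bwd e∈ ◅ _) = Any.map (λ { refl → inj₂ refl }) e∈

  hasEdge⇒covered : ∀ {v} → HasEdge F v → Covered F v
  hasEdge⇒covered {v} h with e , e∈ , v~e ← find h with v Fin.≟ proj₁ e
  ... | yes refl = lose e∈ (inj₁ refl)
  ... | no  v≢e  = connected⇒covered v≢e v~e

  covered⇒hasEdge : ∀ {v} → Covered F v → HasEdge F v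
  covered⇒hasEdge cov with find cov
  ... | e , e∈ , inj₁ refl = lose e∈ ε
  ... | e , e∈ , inj₂ refl = lose e∈ (bwd e∈ ◅ ε)

  hasEdge-resp : ∀ {u v} → Connected F u v → HasEdge F v → HasEdge F u
  hasEdge-resp u~v = Any.map (Eq.transitive _ u~v)

  edgewise-constant : ∀ {k} {f : Fin n → Fin k} → (∀ {e} → e ∈ F → f (proj₁ e) ≡ f (proj₂ e)) →
                      Constant (Connected F) f
  edgewise-constant {f = f} eq u v = Eq.gfold isEquivalence f (λ e∈ → eq e∈)

  -- No edge is connected to two different representatives. The bound makes the truncated exponent
  -- of `Y` in `ξ` exact.
  c≤length : c F ≤ length F
  c≤length = length-≤ (λ v e → connected? F v (proj₁ e)) F
    (AllPairs.map (λ ¬u~v e u~e v~e → ¬u~v (Eq.transitive _ u~e (Eq.symmetric _ v~e)))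
      (AllPairsₚ.filter⁺ (hasEdge? F) (deduplicate-AllPairs (connected? F) (allFin n))))
    (Allₚ.all-filter (hasEdge? F) (components (allFin n) F))

module _ {n k} {L : Pred (Fin k) 0ℓ} (L? : U.Decidable L) (f : Fin n → Fin k) where

  Monochromatic : Pred (Edge n) 0ℓ
  Monochromatic (u , v) = L (f u) × f u ≡ f v

  monochromatic? : U.Decidable Monochromatic
  monochromatic? (u , v) = L? (f u) ×-dec f u Fin.≟ f v

  monochromatic-covered : ∀ {A} → All Monochromatic A → ∀ {v} → Covered A v → L (f v)
  monochromatic-covered mono cov with find cov
  ... | e , e∈ , inj₁ refl = proj₁ (All.lookup mono e∈)
  ... | e , e∈ , inj₂ refl = let l , eq = All.lookup mono e∈ in subst L eq l

  covered-monochromatic : ∀ {A} → (∀ {e} → e ∈ A → f (proj₁ e) ≡ f (proj₂ e)) →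
                          (∀ {v} → Covered A v → L (f v)) → All Monochromatic A
  covered-monochromatic eq l = All.tabulate (λ e∈ → l (lose e∈ (inj₁ refl)) , eq e∈)

  -- For a fixed colouring the indicator is a product over the edges of `A`, so the sum over edge
  -- sets factors into the edge weights of a partition function.
  ∑-subsets-monochromatic : ∀ y E →
    ∑[ A ← subsets E ] (y ^ length A * 𝟙 (All.all? monochromatic? A))
      ≡ ∏[ e ← E ] (1 + y * 𝟙 (monochromatic? e))
  ∑-subsets-monochromatic y E = trans
    (∑-cong (subsets E) (λ A → sym (trans (∏-* (λ _ → y) _ A)
      (cong₂ _*_ (∏-const y A) (∏-𝟙 monochromatic? A)))))
    (∑-subsets _ E)

-- The Potts edge weight `1 + y δ(i , j)`, with the interaction restricted to colours in `L`.
monochromaticWeight : ∀ {k} {L : Pred (Fin k) 0ℓ} → U.Decidable L → ℕ → Fin k → Fin k → ℕ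
monochromaticWeight L? y i j = 1 + y * 𝟙 (L? i ×-dec i Fin.≟ j)

module _ {n k} (F : List (Edge n)) {Allowed : Fin n → Pred (Fin k) 0ℓ}
         (allowed? : ∀ v → U.Decidable (Allowed v)) (α : Fin k → ℕ)
         (spread : ∀ {u v} → u ≢ v → Connected F u v → ∀ {c} → Allowed v c → Allowed u c × α c ≡ 1)
         {P : Pred (Fin n → Fin k) 0ℓ} (P? : U.Decidable P)
         (P⇒ : ∀ {f} → P f → Constant (Connected F) f × (∀ v → Allowed v (f v)))
         (⇒P : ∀ {f} → Constant (Connected F) f → (∀ v → Allowed v (f v)) → P f) where

  -- `P` amounts to constancy on components plus a condition at each vertex, and that condition can
  -- be merged into the vertex weight. In a component with several vertices, `spread` gives an
  -- allowed colour weight 1 and makes it allowed throughout, which is the absorption required by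
  -- `∑-constant-colourings`.
  ∑-colourings-components :
    ∑[ f ← colourings n k ] (𝟙 (P? f) * (∏[ v ← allFin n ] α (f v)))
      ≡ ∏[ r ← components (allFin n) F ] ∑[ d ← allFin k ] (𝟙 (allowed? r d) * α d)
  ∑-colourings-components = trans
    (∑-cong (colourings n k) (λ f → sym (split f)))
    (∑-constant-colourings (connected? F) (Eq.isEquivalence _) (λ v d → 𝟙 (allowed? v d) * α d) absorb)
    where
    absorb : ∀ {u v} → u ≢ v → Connected F u v → ∀ d →
             𝟙 (allowed? u d) * α d * (𝟙 (allowed? v d) * α d) ≡ 𝟙 (allowed? v d) * α d
    absorb {u} {v} u≢v u~v d with allowed? v d
    ... | no  _ = *-zeroʳ (𝟙 (allowed? u d) * α d)
    ... | yes a with a′ , α≡1 ← spread u≢v u~v a rewrite α≡1 | 𝟙-yes (allowed? u d) a′ = refl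

    split : ∀ f → 𝟙 (constant? (connected? F) f) * (∏[ v ← allFin n ] (𝟙 (allowed? v (f v)) * α (f v)))
                  ≡ 𝟙 (P? f) * (∏[ v ← allFin n ] α (f v))
    split f = begin
      𝟙 const? * (∏[ v ← allFin n ] (𝟙 (allowed? v (f v)) * α (f v)))
        ≡⟨ cong (𝟙 const? *_) (trans (∏-* _ (λ v → α (f v)) (allFin n))
             (cong (_* w) (∏-𝟙 (λ v → allowed? v (f v)) (allFin n)))) ⟩
      𝟙 const? * (𝟙 all? * w)
        ≡⟨ *-assoc (𝟙 const?) (𝟙 all?) w ⟨
      𝟙 const? * 𝟙 all? * w
        ≡⟨ cong (_* w) (trans (sym (𝟙-× const? all?)) (𝟙-⇔ (const? ×-dec all?) (P? f)
             (λ (const , all) → ⇒P const (λ v → All.lookup all (∈-allFin v)))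
             (λ p → let const , all = P⇒ p in const , All.universal all (allFin n)))) ⟩
      𝟙 (P? f) * w ∎
      where
      open ≡-Reasoning
      const? = constant? (connected? F) f
      all? = All.all? (λ v → allowed? v (f v)) (allFin n)
      w = ∏[ v ← allFin n ] α (f v)

-- Rearranging sums over subgraphs and over pairs of edge sets.

∑-subgraphs : ∀ {n} (G : Graph n) (h : List (Fin n) → List (Edge n) → ℕ) →
  ∑[ H ← subgraphs G ] h (proj₁ H) (proj₂ H)
    ≡ ∑[ W ← subsets (allFin n) ] ∑[ F ← subsets (edges G) ] (𝟙 (endpointsIn? W F) * h W F)
∑-subgraphs {n} G h = trans
  (∑-filter (λ H → endpointsIn? (proj₁ H) (proj₂ H)) _ (cartesianProduct (subsets (allFin n)) (subsets (edges G))))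
  (∑-cartesianProductWith _,_ _ (subsets (allFin n)) (subsets (edges G)))

∑-disjointPairs : ∀ {n} (G : Graph n) (h : List (Edge n) → List (Edge n) → ℕ) →
  ∑[ P ← disjointPairs G ] h (proj₁ P) (proj₂ P)
    ≡ ∑[ A ← subsets (edges G) ] ∑[ B ← subsets (edges G) ] (𝟙 (vertexDisjoint? A B) * h A B)
∑-disjointPairs G h = trans
  (∑-filter (λ P → vertexDisjoint? (proj₁ P) (proj₂ P)) _ (cartesianProduct (subsets (edges G)) (subsets (edges G))))
  (∑-cartesianProductWith _,_ _ (subsets (edges G)) (subsets (edges G)))

-- Once the colouring `f` is summed last, the sums over `x` and `y` separate and can be evaluated
-- for each colouring.
∑-collect : ∀ (g : A → D → ℕ) (h : B → D → ℕ) (w : D → ℕ) xs ys fs →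
  ∑[ x ← xs ] ∑[ y ← ys ] ∑[ f ← fs ] (g x f * h y f * w f)
    ≡ ∑[ f ← fs ] ((∑[ x ← xs ] g x f) * (∑[ y ← ys ] h y f) * w f)
∑-collect g h w xs ys fs = begin
  ∑[ x ← xs ] ∑[ y ← ys ] ∑[ f ← fs ] (g x f * h y f * w f)
    ≡⟨ ∑-cong xs (λ x → ∑-swap (λ y f → g x f * h y f * w f) ys fs) ⟩
  ∑[ x ← xs ] ∑[ f ← fs ] ∑[ y ← ys ] (g x f * h y f * w f)
    ≡⟨ ∑-swap (λ x f → ∑[ y ← ys ] (g x f * h y f * w f)) xs fs ⟩
  ∑[ f ← fs ] ∑[ x ← xs ] ∑[ y ← ys ] (g x f * h y f * w f)
    ≡⟨ ∑-cong fs (λ f → trans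
         (∑-cong xs (λ x → trans (∑-*ʳ (λ y → g x f * h y f) (w f) ys)
           (cong (_* w f) (∑-*ˡ (g x f) (λ y → h y f) ys))))
         (trans (∑-*ʳ (λ x → g x f * (∑[ y ← ys ] h y f)) (w f) xs)
           (cong (_* w f) (∑-*ʳ (λ x → g x f) (∑[ y ← ys ] h y f) xs)))) ⟩
  ∑[ f ← fs ] ((∑[ x ← xs ] g x f) * (∑[ y ← ys ] h y f) * w f) ∎
  where open ≡-Reasoning

-- Colour `zero` is the dead one, so `Fin (suc k)` has `k` live colours.
Live : ∀ {k} → Pred (Fin k) 0ℓ
Live c = 0 < toℕ c

live? : ∀ {k} → U.Decidable (Live {k})
live? c = 0 <? toℕ c

-- The subgraph counting polynomial

module _ {n : ℕ} (W : List (Fin n)) (F : List (Edge n)) (Y : ℕ) where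
  open DecMembership (Fin._≟_ {n}) using (_∈?_)

  private
    MonoAgrees? : U.Decidable (λ f → All (Monochromatic (live? {suc Y}) f) F × All (Agrees (live? ∘ f) W) (allFin n))
    MonoAgrees? f = All.all? (monochromatic? live? f) F ×-dec All.all? (agrees? (live? ∘ f) W) (allFin n)

  -- The colourings counted are live exactly on `W` and monochromatic on `F`. An edge of `F` leaving
  -- `W` excludes them all, since its ends would have to be live. Otherwise a component inside `W`
  -- has `Y` choices, and one outside `W` has only the dead colour.
  ∑-colourings-supported : W ∈ subsets (allFin n) →
    ∑[ f ← colourings n (suc Y) ]
      (𝟙 (All.all? (agrees? (live? ∘ f) W) (allFin n)) * 𝟙 (All.all? (monochromatic? live? f) F))
      ≡ 𝟙 (endpointsIn? W F) * Y ^ κ′ W F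
  ∑-colourings-supported W∈ with endpointsIn? W F
  ... | no ¬inside = trans
    (∑-cong (colourings n (suc Y)) (λ f → trans (*-comm (𝟙 (All.all? (agrees? (live? ∘ f) W) (allFin n))) _)
      (trans (sym (𝟙-× (All.all? (monochromatic? live? f) F) (All.all? (agrees? (live? ∘ f) W) (allFin n))))
        (𝟙-no (MonoAgrees? f) (λ (mono , agrees) → ¬inside (All.map (λ {e} (l , eq) →
          proj₂ (All.lookup agrees (∈-allFin (proj₁ e))) l ,
          proj₂ (All.lookup agrees (∈-allFin (proj₂ e))) (subst Live eq l)) mono))))))
    (∑-0 (colourings n (suc Y)))
  ... | yes inside = begin
    ∑[ f ← colourings n (suc Y) ]
      (𝟙 (All.all? (agrees? (live? ∘ f) W) (allFin n)) * 𝟙 (All.all? (monochromatic? live? f) F))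
      ≡⟨ ∑-cong (colourings n (suc Y)) (λ f → trans (*-comm (𝟙 (All.all? (agrees? (live? ∘ f) W) (allFin n))) _)
           (trans (sym (𝟙-× (All.all? (monochromatic? live? f) F) (All.all? (agrees? (live? ∘ f) W) (allFin n))))
             (sym (trans (cong (𝟙 (MonoAgrees? f) *_) (∏-1 (allFin n))) (*-identityʳ _))))) ⟩
    ∑[ f ← colourings n (suc Y) ] (𝟙 (MonoAgrees? f) * (∏[ v ← allFin n ] 1))
      ≡⟨ ∑-colourings-components F allowed? (λ _ → 1)
           (λ _ u~v (to , from) → ((λ u∈W → to (closed (Eq.symmetric _ u~v) u∈W)) , (λ l → closed u~v (from l))) , refl)
           MonoAgrees?
           (λ {f} (mono , agrees) →
             edgewise-constant {f = f} (λ e∈ → proj₂ (All.lookup mono e∈)) ,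
             (λ v → All.lookup agrees (∈-allFin v)))
           (λ {f} const allowed →
             All.tabulate (λ {e} e∈ → proj₁ (allowed (proj₁ e)) (proj₁ (All.lookup inside e∈)) ,
                                  const (proj₁ e) (proj₂ e) (fwd e∈ ◅ ε)) ,
             All.universal allowed (allFin n)) ⟩
    ∏[ r ← components (allFin n) F ] ∑[ d ← allFin (suc Y) ] (𝟙 (allowed? r d) * 1)
      ≡⟨ ∏-cong (components (allFin n) F) count ⟩
    ∏[ r ← components (allFin n) F ] (if does (r ∈? W) then Y else 1)
      ≡⟨ trans (sym (∏-filter (_∈? W) (λ _ → Y) (components (allFin n) F))) (∏-const Y (filter (_∈? W) (components (allFin n) F))) ⟩
    Y ^ length (filter (_∈? W) (components (allFin n) F))
      -- Each component of `F` on all vertices lies inside `W` or avoids it, so those inside are the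
      -- components of `(W , F)`.
      ≡⟨ cong (λ rs → Y ^ length rs) (trans
           (filter-deduplicate (connected? F) (_∈? W) closed (allFin n))
           (cong (λ vs → components vs F) (filter-∈-subset (allFin⁺ n) W∈))) ⟩
    Y ^ κ′ W F
      ≡⟨ *-identityˡ _ ⟨
    1 * Y ^ κ′ W F ∎
    where
    open ≡-Reasoning

    allowed? : ∀ v → U.Decidable (λ (c : Fin (suc Y)) → (v ∈ W → Live c) × (Live c → v ∈ W))
    allowed? v c = (v ∈? W →-dec live? c) ×-dec (live? c →-dec v ∈? W)

    closed : ∀ {u v} → Connected F u v → v ∈ W → u ∈ W
    closed {u} {v} u~v v∈W with u Fin.≟ v
    ... | yes refl = v∈W
    ... | no  u≢v with find (connected⇒covered u≢v u~v)
    ...   | e , e∈ , inj₁ refl = proj₁ (All.lookup inside e∈)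
    ...   | e , e∈ , inj₂ refl = proj₂ (All.lookup inside e∈)

    count : ∀ r → ∑[ d ← allFin (suc Y) ] (𝟙 (allowed? r d) * 1) ≡ (if does (r ∈? W) then Y else 1)
    count r = trans (∑-allFin-suc Y (λ d → 𝟙 (allowed? r d) * 1)) byCases
      where
      byCases : 𝟙 (allowed? r zero) * 1 + (∑[ d ← allFin Y ] (𝟙 (allowed? r (suc d)) * 1))
                ≡ (if does (r ∈? W) then Y else 1)
      byCases with r ∈? W
      ... | yes _ = ∑-allFin-1 Y
      ... | no  _ = cong suc (∑-0 (allFin Y))

-- An exact equality, without a modulus: `W` is the set of live vertices, each of weight `X`, and
-- dead vertices have weight 1.
S≡partitionFunction : ∀ n X Y Z → S (K n) X Y Z ≡
  partitionFunction (monochromaticWeight (live? {suc Y}) Z) n (λ d → if does (live? d) then X else 1)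
S≡partitionFunction n X Y Z = begin
  S (K n) X Y Z
    ≡⟨ ∑-subgraphs (K n) (λ W F → X ^ length W * Y ^ κ′ W F * Z ^ length F) ⟩
  ∑[ W ← subsets V ] ∑[ F ← subsets E ] (𝟙 (endpointsIn? W F) * (X ^ length W * Y ^ κ′ W F * Z ^ length F))
    ≡⟨ ∑-cong-∈ (subsets V) (λ {W} W∈ → ∑-cong (subsets E) (λ F → expand W W∈ F)) ⟩
  ∑[ W ← subsets V ] ∑[ F ← subsets E ] ∑[ f ← fs ] (g W f * h F f * 1)
    ≡⟨ ∑-collect g h (λ _ → 1) (subsets V) (subsets E) fs ⟩
  ∑[ f ← fs ] ((∑[ W ← subsets V ] g W f) * (∑[ F ← subsets E ] h F f) * 1)
    ≡⟨ ∑-cong fs (λ f → trans (*-identityʳ _)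
         (cong₂ _*_ (∑-subsets-agreeing (live? ∘ f) X (allFin⁺ n)) (∑-subsets-monochromatic live? f Z E))) ⟩
  partitionFunction (monochromaticWeight live? Z) n (λ d → if does (live? d) then X else 1) ∎
  where
  open ≡-Reasoning
  V = allFin n
  E = edges (K n)
  fs = colourings n (suc Y)

  g : List (Fin n) → (Fin n → Fin (suc Y)) → ℕ
  g W f = X ^ length W * 𝟙 (All.all? (agrees? (live? ∘ f) W) V)

  h : List (Edge n) → (Fin n → Fin (suc Y)) → ℕ
  h F f = Z ^ length F * 𝟙 (All.all? (monochromatic? live? f) F)

  shuffle : ∀ x y z i → i * (x * y * z) ≡ x * z * (i * y)
  shuffle = solve-∀
  shuffle′ : ∀ x z i j → x * z * (i * j) ≡ x * i * (z * j) * 1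
  shuffle′ = solve-∀

  expand : ∀ W → W ∈ subsets V → ∀ F →
    𝟙 (endpointsIn? W F) * (X ^ length W * Y ^ κ′ W F * Z ^ length F) ≡ ∑[ f ← fs ] (g W f * h F f * 1)
  expand W W∈ F = begin
    𝟙 (endpointsIn? W F) * (X ^ length W * Y ^ κ′ W F * Z ^ length F)
      ≡⟨ shuffle (X ^ length W) (Y ^ κ′ W F) (Z ^ length F) (𝟙 (endpointsIn? W F)) ⟩
    X ^ length W * Z ^ length F * (𝟙 (endpointsIn? W F) * Y ^ κ′ W F)
      ≡⟨ cong (X ^ length W * Z ^ length F *_) (∑-colourings-supported W F Y W∈) ⟨
    X ^ length W * Z ^ length F *
      (∑[ f ← fs ] (𝟙 (All.all? (agrees? (live? ∘ f) W) V) * 𝟙 (All.all? (monochromatic? live? f) F)))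
      ≡⟨ ∑-*ˡ (X ^ length W * Z ^ length F) _ fs ⟨
    ∑[ f ← fs ] (X ^ length W * Z ^ length F *
      (𝟙 (All.all? (agrees? (live? ∘ f) W) V) * 𝟙 (All.all? (monochromatic? live? f) F)))
      ≡⟨ ∑-cong fs (λ f → shuffle′ (X ^ length W) (Z ^ length F)
           (𝟙 (All.all? (agrees? (live? ∘ f) W) V)) (𝟙 (All.all? (monochromatic? live? f) F))) ⟩
    ∑[ f ← fs ] (g W f * h F f * 1) ∎

-- The covered components and edge elimination polynomials

^-distribʳ-* : ∀ a b n → (a * b) ^ n ≡ a ^ n * b ^ n
^-distribʳ-* a b zero    = refl
^-distribʳ-* a b (suc n) = trans (cong (a * b *_) (^-distribʳ-* a b n)) (*-Properties.interchange a b (a ^ n) (b ^ n))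

-- The power of `t * (a * b)` supplies the factors `a ^ x` and `b ^ x` that the lowered exponents
-- lack.
^-∸-absorb : ∀ a b t {k l x} → x ≤ k → x ≤ l →
  a ^ (k ∸ x) * b ^ (l ∸ x) * (t * (a * b)) ^ x ≡ a ^ k * b ^ l * t ^ x
^-∸-absorb a b t {k} {l} {x} x≤k x≤l = begin
  a ^ (k ∸ x) * b ^ (l ∸ x) * (t * (a * b)) ^ x
    ≡⟨ cong (a ^ (k ∸ x) * b ^ (l ∸ x) *_)
         (trans (^-distribʳ-* t (a * b) x) (cong (t ^ x *_) (^-distribʳ-* a b x))) ⟩
  a ^ (k ∸ x) * b ^ (l ∸ x) * (t ^ x * (a ^ x * b ^ x))
    ≡⟨ shuffle (a ^ (k ∸ x)) (b ^ (l ∸ x)) (t ^ x) (a ^ x) (b ^ x) ⟩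
  a ^ (k ∸ x) * a ^ x * (b ^ (l ∸ x) * b ^ x) * t ^ x
    ≡⟨ cong₂ (λ r s → r * s * t ^ x) (recombine a x≤k) (recombine b x≤l) ⟩
  a ^ k * b ^ l * t ^ x ∎
  where
  open ≡-Reasoning
  shuffle : ∀ p q r s u → p * q * (r * (s * u)) ≡ p * s * (q * u) * r
  shuffle = solve-∀
  recombine : ∀ a {k} → x ≤ k → a ^ (k ∸ x) * a ^ x ≡ a ^ k
  recombine a {k} x≤k = trans (sym (^-distribˡ-+-* a (k ∸ x) x)) (cong (a ^_) (m∸n+n≡m x≤k))

-- Two disjoint palettes of live colours: in `ξ` the first is for the components of `A`, the second
-- for those of `B`.
LiveUpTo LiveAbove : ℕ → ∀ {k} → Pred (Fin k) 0ℓ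
LiveUpTo  p d = Live d × toℕ d ≤ p
LiveAbove p d = p < toℕ d

liveUpTo? : ∀ p {k} → U.Decidable (LiveUpTo p {k})
liveUpTo? p d = live? d ×-dec toℕ d ≤? p

liveAbove? : ∀ p {k} → U.Decidable (LiveAbove p {k})
liveAbove? p d = p <? toℕ d

-- One dead colour of weight `s` stands for `s` interchangeable dead colours.
deadWeight : ∀ {k} → ℕ → Fin k → ℕ
deadWeight s d = if does (live? d) then 1 else s

deadWeight-live : ∀ {k} s (d : Fin k) → Live d → deadWeight s d ≡ 1
deadWeight-live s d l = cong (if_then 1 else s) (dec-true (live? d) l)

∑-deadWeight : ∀ s k → ∑ (allFin (suc k)) (deadWeight s) ≡ s + k
∑-deadWeight s k = trans (∑-allFin-suc k (deadWeight s)) (cong (s +_) (∑-allFin-1 k))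

∑-deadWeight-live : ∀ s k → ∑[ d ← allFin (suc k) ] (𝟙 (live? d) * deadWeight s d) ≡ k
∑-deadWeight-live s k = trans (∑-allFin-suc k (λ d → 𝟙 (live? d) * deadWeight s d)) (∑-allFin-1 k)

module _ (s p q : ℕ) where

  private
    ∑-deadWeight-split : ∀ {Q : Pred (Fin (suc (p + q))) 0ℓ} (Q? : U.Decidable Q) →
      𝟙 (Q? zero) ≡ 0 → ∀ i j →
      (∀ d → 𝟙 (Q? (suc (d ↑ˡ q))) ≡ i) → (∀ d → 𝟙 (Q? (suc (p ↑ʳ d))) ≡ j) →
      ∑[ d ← allFin (suc (p + q)) ] (𝟙 (Q? d) * deadWeight s d) ≡ i * p + j * q
    ∑-deadWeight-split Q? q0 i j low high = begin
      ∑[ d ← allFin (suc (p + q)) ] (𝟙 (Q? d) * deadWeight s d)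
        ≡⟨ ∑-allFin-suc (p + q) (λ d → 𝟙 (Q? d) * deadWeight s d) ⟩
      𝟙 (Q? zero) * s + (∑[ d ← allFin (p + q) ] (𝟙 (Q? (suc d)) * 1))
        ≡⟨ cong₂ _+_ (cong (_* s) q0) (∑-allFin-+ p q (λ d → 𝟙 (Q? (suc d)) * 1)) ⟩
      (∑[ d ← allFin p ] (𝟙 (Q? (suc (d ↑ˡ q))) * 1)) + (∑[ d ← allFin q ] (𝟙 (Q? (suc (p ↑ʳ d))) * 1))
        ≡⟨ cong₂ _+_ (trans (∑-cong (allFin p) (λ d → cong (_* 1) (low d))) (∑-*ˡ i (λ _ → 1) (allFin p)))
                     (trans (∑-cong (allFin q) (λ d → cong (_* 1) (high d))) (∑-*ˡ j (λ _ → 1) (allFin q))) ⟩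
      i * (∑[ d ← allFin p ] 1) + j * (∑[ d ← allFin q ] 1)
        ≡⟨ cong₂ (λ x y → i * x + j * y) (∑-allFin-1 p) (∑-allFin-1 q) ⟩
      i * p + j * q ∎
      where open ≡-Reasoning

    low-≤ : ∀ (d : Fin p) → suc (toℕ (d ↑ˡ q)) ≤ p
    low-≤ d = subst (_< p) (sym (Fin.toℕ-↑ˡ d q)) (Fin.toℕ<n d)

    high-> : ∀ (d : Fin q) → p < suc (toℕ (p ↑ʳ d))
    high-> d = s≤s (subst (p ≤_) (sym (Fin.toℕ-↑ʳ p d)) (m≤m+n p (toℕ d)))

  ∑-deadWeight-upTo : ∑[ d ← allFin (suc (p + q)) ] (𝟙 (liveUpTo? p d) * deadWeight s d) ≡ p
  ∑-deadWeight-upTo = trans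
    (∑-deadWeight-split (liveUpTo? p) refl 1 0
      (λ d → 𝟙-yes (liveUpTo? p (suc (d ↑ˡ q))) (z<s , low-≤ d))
      (λ d → 𝟙-no (liveUpTo? p (suc (p ↑ʳ d))) (λ (_ , ≤p) → <⇒≱ (high-> d) ≤p)))
    (trans (+-identityʳ _) (+-identityʳ p))

  ∑-deadWeight-above : ∑[ d ← allFin (suc (p + q)) ] (𝟙 (liveAbove? p d) * deadWeight s d) ≡ q
  ∑-deadWeight-above = trans
    (∑-deadWeight-split (liveAbove? p) (𝟙-no (liveAbove? p {suc (p + q)} zero) (λ ())) 0 1
      (λ d → 𝟙-no (liveAbove? p (suc (d ↑ˡ q))) (λ p< → <⇒≱ p< (low-≤ d)))
      (λ d → 𝟙-yes (liveAbove? p (suc (p ↑ʳ d))) (high-> d)))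
    (+-identityʳ q)

-- Components of the union of two vertex-disjoint edge sets.

module _ {n} {A F : List (Edge n)} where

  covered-closed : (∀ {u v} → (u , v) ∈ F → (Covered A u → Covered A v) × (Covered A v → Covered A u)) →
                   ∀ {u v} → Connected F u v → Covered A u → Covered A v
  covered-closed step ε            cov = cov
  covered-closed step (fwd e∈ ◅ r) cov = covered-closed step r (proj₁ (step e∈) cov)
  covered-closed step (bwd e∈ ◅ r) cov = covered-closed step r (proj₂ (step e∈) cov)

module _ {n} {A B : List (Edge n)} (disjoint : VertexDisjoint A B) where

  disjoint-step : ∀ {u v} → (u , v) ∈ A ++ B →
    ((u , v) ∈ A × ¬ Covered B u × ¬ Covered B v) ⊎ ((u , v) ∈ B × ¬ Covered A u × ¬ Covered A v)
  disjoint-step {u} {v} e∈ with ∈-++⁻ A e∈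
  ... | inj₁ e∈A = inj₁ (e∈A , (λ cov → disjoint u (lose e∈A (inj₁ refl) , cov))
                             , (λ cov → disjoint v (lose e∈A (inj₂ refl) , cov)))
  ... | inj₂ e∈B = inj₂ (e∈B , (λ cov → disjoint u (cov , lose e∈B (inj₁ refl)))
                             , (λ cov → disjoint v (cov , lose e∈B (inj₂ refl))))

  covered-closedˡ : ∀ {u v} → Connected (A ++ B) u v → Covered A u → Covered A v
  covered-closedˡ = covered-closed (λ e∈ → [
    (λ (e∈A , _) → (λ _ → lose e∈A (inj₂ refl)) , (λ _ → lose e∈A (inj₁ refl))) ,
    (λ (_ , ¬u , ¬v) → (λ cov → contradiction cov ¬u) , (λ cov → contradiction cov ¬v)) ]′ (disjoint-step e∈))

  covered-closedʳ : ∀ {u v} → Connected (A ++ B) u v → Covered B u → Covered B v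
  covered-closedʳ = covered-closed (λ e∈ → [
    (λ (_ , ¬u , ¬v) → (λ cov → contradiction cov ¬u) , (λ cov → contradiction cov ¬v)) ,
    (λ (e∈B , _) → (λ _ → lose e∈B (inj₂ refl)) , (λ _ → lose e∈B (inj₁ refl))) ]′ (disjoint-step e∈))

  -- A walk starting at a vertex covered by `B` never leaves `B`: a step along `A` would start at a
  -- vertex covered by both.
  connected-restrictʳ : ∀ {u v} → Connected (A ++ B) u v → Covered B u → Connected B u v
  connected-restrictʳ ε            cov = ε
  connected-restrictʳ (fwd e∈ ◅ r) cov with disjoint-step e∈
  ... | inj₁ (_ , ¬u , _) = contradiction cov ¬u
  ... | inj₂ (e∈B , _)    = fwd e∈B ◅ connected-restrictʳ r (lose e∈B (inj₂ refl))
  connected-restrictʳ (bwd e∈ ◅ r) cov with disjoint-step e∈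
  ... | inj₁ (_ , _ , ¬v) = contradiction cov ¬v
  ... | inj₂ (e∈B , _)    = bwd e∈B ◅ connected-restrictʳ r (lose e∈B (inj₁ refl))

  -- On the vertices that `B` covers, being connected in `A ++ B` and in `B` coincide, so both sides
  -- pick representatives of the same filtered list by the same relation.
  c-disjoint-++ : length (filter (hasEdge? B) (components (allFin n) (A ++ B))) ≡ c B
  c-disjoint-++ = cong length (begin
    filter (hasEdge? B) (components (allFin n) (A ++ B))
      ≡⟨ filter-deduplicate (connected? (A ++ B)) (hasEdge? B)
           (λ u~v h → covered⇒hasEdge (covered-closedʳ (Eq.symmetric _ u~v) (hasEdge⇒covered h)))
           (allFin n) ⟩
    deduplicate (connected? (A ++ B)) (filter (hasEdge? B) (allFin n))
      ≡⟨ deduplicate-cong (connected? (A ++ B)) (connected? B) (filter (hasEdge? B) (allFin n))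
           (λ {u} {v} u∈ _ → does-⇔ (mk⇔
             (λ u~v → connected-restrictʳ u~v
               (hasEdge⇒covered (All.lookup (Allₚ.all-filter (hasEdge? B) (allFin n)) u∈)))
             (Eq.map (∈-++⁺ʳ A)))
             (connected? (A ++ B) u v) (connected? B u v)) ⟩
    deduplicate (connected? B) (filter (hasEdge? B) (allFin n))
      ≡⟨ filter-deduplicate (connected? B) (hasEdge? B) hasEdge-resp (allFin n) ⟨
    filter (hasEdge? B) (components (allFin n) B) ∎)
    where open ≡-Reasoning

  c-disjoint≤κ-++ : c B ≤ κ (A ++ B)
  c-disjoint≤κ-++ = subst (_≤ κ (A ++ B)) c-disjoint-++
    (length-filter (hasEdge? B) (components (allFin n) (A ++ B)))

-- Modulo 1 + m the a * t * m dead colours count as - a * t, so that a vertex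
-- without edges has a + a * t + a * t * m ≋ a colours to choose from.
module _ (m a t : ℕ) where
  open Congruence m

  private
    s k : ℕ
    s = a * t * m
    k = suc (a + a * t)

    α : Fin k → ℕ
    α = deadWeight s

  ∑-deadWeight-≋ : ∑ (allFin k) α ≋ a * 1
  ∑-deadWeight-≋ = begin
    ∑ (allFin k) α        ≡⟨ ∑-deadWeight s (a + a * t) ⟩
    s + (a + a * t)       ≡⟨ shuffle a (a * t) m ⟩
    a * 1 + a * t * suc m ≈⟨ ≋-intro ([m+kn]%n≡m%n (a * 1) (a * t) (suc m)) ⟩
    a * 1                 ∎
    where
    open ≋-Reasoning
    shuffle : ∀ a b m → b * m + (a + b) ≡ a * 1 + b * suc m
    shuffle = solve-∀

  -- A component with an edge takes one of the `a * suc t` live colours. An isolated vertex may also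
  -- be dead, which brings its total weight to `a` modulo `suc m`.
  ∑-colourings-monochromatic : ∀ {n} (A : List (Edge n)) →
    ∑[ f ← colourings n k ] (𝟙 (All.all? (monochromatic? live? f) A) * (∏[ v ← allFin n ] α (f v)))
      ≋ a ^ κ A * suc t ^ c A
  ∑-colourings-monochromatic {n} A = begin
    ∑[ f ← colourings n k ] (𝟙 (All.all? (monochromatic? live? f) A) * (∏[ v ← allFin n ] α (f v)))
      ≡⟨ ∑-colourings-components A allowed? α
           -- The reversed walk starts with an edge at `v`, so `v` is covered and its colour is
           -- live.
           (λ u≢v u~v {d} allowed →
             let l = allowed (connected⇒covered (u≢v ∘ sym) (Eq.symmetric _ u~v)) in
             (λ _ → l) , deadWeight-live s d l)
           (λ f → All.all? (monochromatic? live? f) A)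
           (λ {f} mono → edgewise-constant {f = f} (λ e∈ → proj₂ (All.lookup mono e∈)) ,
                         (λ v → monochromatic-covered live? f mono))
           (λ {f} const allowed → covered-monochromatic live? f
             (λ e∈ → const _ _ (fwd e∈ ◅ ε)) (λ {v} → allowed v)) ⟩
    ∏[ r ← components (allFin n) A ] ∑[ d ← allFin k ] (𝟙 (allowed? r d) * α d)
      ≈⟨ ∏-≋ (components (allFin n) A) count ⟩
    ∏[ r ← components (allFin n) A ] (a * (if does (hasEdge? A r) then suc t else 1))
      ≡⟨ ∏-marked (hasEdge? A) a (suc t) (components (allFin n) A) ⟩
    a ^ κ A * suc t ^ c A ∎
    where
    open ≋-Reasoning

    allowed? : ∀ v → U.Decidable (λ d → Covered A v → Live d)
    allowed? v d = covered? A v →-dec live? d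

    count : ∀ r → ∑[ d ← allFin k ] (𝟙 (allowed? r d) * α d)
                  ≋ a * (if does (hasEdge? A r) then suc t else 1)
    count r with hasEdge? A r
    ... | yes h = ≡⇒≋ (trans
      (∑-cong (allFin k) (λ d → cong (_* α d)
        (𝟙-⇔ (allowed? r d) (live? d) (λ l → l (hasEdge⇒covered h)) const)))
      (trans (∑-deadWeight-live s (a + a * t)) (sym (*-suc a t))))
    ... | no ¬h = begin
      ∑[ d ← allFin k ] (𝟙 (allowed? r d) * α d)
        ≡⟨ ∑-cong (allFin k) (λ d → trans
             (cong (_* α d) (𝟙-yes (allowed? r d) (λ cov → contradiction (covered⇒hasEdge cov) ¬h)))
             (*-identityˡ (α d))) ⟩
      ∑ (allFin k) α ≈⟨ ∑-deadWeight-≋ ⟩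
      a * 1          ∎

  module _ {n} (A B : List (Edge n)) where

    private
      Both? : U.Decidable (λ (f : Fin n → Fin k) →
        All (Monochromatic (liveUpTo? a) f) A × All (Monochromatic (liveAbove? a) f) B)
      Both? f = All.all? (monochromatic? (liveUpTo? a) f) A ×-dec All.all? (monochromatic? (liveAbove? a) f) B

    -- A vertex covered by both sets would need a colour from both palettes. If there is none, a
    -- component has `a * t` colours when it has an edge of `B`, `a` when it has an edge of `A`, and
    -- total weight `a` modulo `suc m` when it is an isolated vertex.
    ∑-colourings-bichromatic : (disjoint? : Dec (VertexDisjoint A B)) →
      ∑[ f ← colourings n k ] (𝟙 (Both? f) * (∏[ v ← allFin n ] α (f v)))
        ≋ 𝟙 disjoint? * (a ^ κ (A ++ B) * t ^ c B)
    ∑-colourings-bichromatic (no ¬disjoint) = ≡⇒≋ (trans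
      (∑-cong (colourings n k) (λ f → cong (_* (∏[ v ← allFin n ] α (f v)))
        (𝟙-no (Both? f) (λ (monoA , monoB) → ¬disjoint (λ v (covA , covB) →
          <⇒≱ (monochromatic-covered (liveAbove? a) f monoB covB)
              (proj₂ (monochromatic-covered (liveUpTo? a) f monoA covA)))))))
      (∑-0 (colourings n k)))
    ∑-colourings-bichromatic (yes disjoint) = begin
      ∑[ f ← colourings n k ] (𝟙 (Both? f) * (∏[ v ← allFin n ] α (f v)))
        ≡⟨ ∑-colourings-components (A ++ B) allowed? α spread Both?
             (λ {f} (monoA , monoB) →
               edgewise-constant {f = f} (λ e∈ → [ (λ e∈A → proj₂ (All.lookup monoA e∈A)) ,
                                                   (λ e∈B → proj₂ (All.lookup monoB e∈B)) ]′ (∈-++⁻ A e∈)) ,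
               (λ v → monochromatic-covered (liveUpTo? a) f monoA , monochromatic-covered (liveAbove? a) f monoB))
             (λ {f} const allowed →
               covered-monochromatic (liveUpTo? a) f (λ e∈ → const _ _ (fwd (∈-++⁺ˡ e∈) ◅ ε)) (λ {v} → proj₁ (allowed v)) ,
               covered-monochromatic (liveAbove? a) f (λ e∈ → const _ _ (fwd (∈-++⁺ʳ A e∈) ◅ ε)) (λ {v} → proj₂ (allowed v))) ⟩
      ∏[ r ← components (allFin n) (A ++ B) ] ∑[ d ← allFin k ] (𝟙 (allowed? r d) * α d)
        ≈⟨ ∏-≋ (components (allFin n) (A ++ B)) count ⟩
      ∏[ r ← components (allFin n) (A ++ B) ] (a * (if does (hasEdge? B r) then t else 1))
        ≡⟨ ∏-marked (hasEdge? B) a t (components (allFin n) (A ++ B)) ⟩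
      a ^ κ (A ++ B) * t ^ length (filter (hasEdge? B) (components (allFin n) (A ++ B)))
        ≡⟨ cong (λ x → a ^ κ (A ++ B) * t ^ x) (c-disjoint-++ disjoint) ⟩
      a ^ κ (A ++ B) * t ^ c B
        ≡⟨ *-identityˡ _ ⟨
      1 * (a ^ κ (A ++ B) * t ^ c B) ∎
      where
      open ≋-Reasoning

      allowed? : ∀ v → U.Decidable (λ d → (Covered A v → LiveUpTo a d) × (Covered B v → LiveAbove a d))
      allowed? v d = (covered? A v →-dec liveUpTo? a d) ×-dec (covered? B v →-dec liveAbove? a d)

      spread : ∀ {u v} → u ≢ v → Connected (A ++ B) u v → ∀ {d : Fin k} →
        (Covered A v → LiveUpTo a d) × (Covered B v → LiveAbove a d) →
        ((Covered A u → LiveUpTo a d) × (Covered B u → LiveAbove a d)) × α d ≡ 1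
      spread {u} {v} u≢v u~v {d} (lA , lB) =
        ((λ cov → lA (covered-closedˡ disjoint u~v cov)) , (λ cov → lB (covered-closedʳ disjoint u~v cov))) ,
        deadWeight-live s d ([ (λ cov → proj₁ (lA cov)) , (λ cov → ≤-<-trans z≤n (lB cov)) ]′
          (Anyₚ.++⁻ A (connected⇒covered (u≢v ∘ sym) (Eq.symmetric _ u~v))))

      count : ∀ r → ∑[ d ← allFin k ] (𝟙 (allowed? r d) * α d)
                    ≋ a * (if does (hasEdge? B r) then t else 1)
      count r = byCases (hasEdge? B r) (covered? A r)
        where
        byCases : (hasB? : Dec (HasEdge B r)) → Dec (Covered A r) →
          ∑[ d ← allFin k ] (𝟙 (allowed? r d) * α d) ≋ a * (if does hasB? then t else 1)
        byCases (yes h) _ = ≡⇒≋ (trans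
          (∑-cong (allFin k) (λ d → cong (_* α d) (𝟙-⇔ (allowed? r d) (liveAbove? a d)
            (λ (_ , lB) → lB (hasEdge⇒covered h))
            (λ l → (λ cov → contradiction (cov , hasEdge⇒covered h) (disjoint r)) , (λ _ → l)))))
          (∑-deadWeight-above s a (a * t)))
        byCases (no ¬h) (yes covA) = ≡⇒≋ (trans
          (∑-cong (allFin k) (λ d → cong (_* α d) (𝟙-⇔ (allowed? r d) (liveUpTo? a d)
            (λ (lA , _) → lA covA)
            (λ l → (λ _ → l) , (λ cov → contradiction (covered⇒hasEdge cov) ¬h)))))
          (trans (∑-deadWeight-upTo s a (a * t)) (sym (*-identityʳ a))))
        byCases (no ¬h) (no ¬covA) = begin
          ∑[ d ← allFin k ] (𝟙 (allowed? r d) * α d)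
            ≡⟨ ∑-cong (allFin k) (λ d → trans
                 (cong (_* α d) (𝟙-yes (allowed? r d)
                   ((λ cov → contradiction cov ¬covA) , (λ cov → contradiction (covered⇒hasEdge cov) ¬h))))
                 (*-identityˡ (α d))) ⟩
          ∑ (allFin k) α ≈⟨ ∑-deadWeight-≋ ⟩
          a * 1          ∎

-- `C` and `ξ` of complete graphs as partition functions modulo `suc m`.

module _ (m a b t : ℕ) where
  open Congruence m

  private
    k : ℕ
    k = suc (a + a * t)

    α : Fin k → ℕ
    α = deadWeight (a * t * m)

    weight : ∀ {n} → (Fin n → Fin k) → ℕ
    weight {n} f = ∏[ v ← allFin n ] α (f v)

  C≋partitionFunction : ∀ n → C (K n) a b (suc t) ≋ partitionFunction (monochromaticWeight live? b) n α
  C≋partitionFunction n = begin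
    ∑[ A ← subsets E ] (a ^ κ A * b ^ length A * suc t ^ c A)
      ≈⟨ ∑-≋ (subsets E) expand ⟩
    ∑[ A ← subsets E ] ∑[ f ← fs ] (g A f * weight f)
      ≡⟨ ∑-swap (λ A f → g A f * weight f) (subsets E) fs ⟩
    ∑[ f ← fs ] ∑[ A ← subsets E ] (g A f * weight f)
      ≡⟨ ∑-cong fs (λ f → trans (∑-*ʳ (λ A → g A f) (weight f) (subsets E)) (trans
           (cong (_* weight f) (∑-subsets-monochromatic live? f b E))
           (*-comm _ (weight f)))) ⟩
    partitionFunction (monochromaticWeight live? b) n α ∎
    where
    open ≋-Reasoning
    E = edges (K n)
    fs = colourings n k

    g : List (Edge n) → (Fin n → Fin k) → ℕ
    g A f = b ^ length A * 𝟙 (All.all? (monochromatic? live? f) A)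

    shuffle : ∀ x y z → x * y * z ≡ y * (x * z)
    shuffle = solve-∀

    expand : ∀ A → a ^ κ A * b ^ length A * suc t ^ c A ≋ ∑[ f ← fs ] (g A f * weight f)
    expand A = begin
      a ^ κ A * b ^ length A * suc t ^ c A
        ≡⟨ shuffle (a ^ κ A) (b ^ length A) (suc t ^ c A) ⟩
      b ^ length A * (a ^ κ A * suc t ^ c A)
        ≈⟨ *-≋ (≋-refl {b ^ length A}) (∑-colourings-monochromatic m a t A) ⟨
      b ^ length A * (∑[ f ← fs ] (𝟙 (All.all? (monochromatic? live? f) A) * weight f))
        ≡⟨ ∑-*ˡ (b ^ length A) _ fs ⟨
      ∑[ f ← fs ] (b ^ length A * (𝟙 (All.all? (monochromatic? live? f) A) * weight f))
        ≡⟨ ∑-cong fs (λ f → sym (*-assoc (b ^ length A) _ (weight f))) ⟩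
      ∑[ f ← fs ] (g A f * weight f) ∎

  -- One factor comes from summing over `A`, the other from summing over `B`; as the palettes are
  -- disjoint, at most one of them differs from 1.
  bichromaticWeight : Fin k → Fin k → ℕ
  bichromaticWeight i j = monochromaticWeight (liveUpTo? a) b i j * monochromaticWeight (liveAbove? a) b i j

  ξ≋partitionFunction : ∀ n → ξ (K n) a b (t * (a * b)) ≋ partitionFunction bichromaticWeight n α
  ξ≋partitionFunction n = begin
    ξ (K n) a b (t * (a * b))
      ≡⟨ ∑-disjointPairs (K n) term ⟩
    ∑[ A ← subsets E ] ∑[ B ← subsets E ] (𝟙 (vertexDisjoint? A B) * term A B)
      ≈⟨ ∑-≋ (subsets E) (λ A → ∑-≋ (subsets E) (expand A)) ⟩
    ∑[ A ← subsets E ] ∑[ B ← subsets E ] ∑[ f ← fs ] (g A f * h B f * weight f)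
      ≡⟨ ∑-collect g h weight (subsets E) (subsets E) fs ⟩
    ∑[ f ← fs ] ((∑[ A ← subsets E ] g A f) * (∑[ B ← subsets E ] h B f) * weight f)
      ≡⟨ ∑-cong fs (λ f → trans
           (cong (_* weight f) (trans
             (cong₂ _*_ (∑-subsets-monochromatic (liveUpTo? a) f b E)
                        (∑-subsets-monochromatic (liveAbove? a) f b E))
             (sym (∏-* _ _ E))))
           (*-comm _ (weight f))) ⟩
    partitionFunction bichromaticWeight n α ∎
    where
    open ≋-Reasoning
    E = edges (K n)
    fs = colourings n k

    term : List (Edge n) → List (Edge n) → ℕ
    term A B = a ^ (κ (A ++ B) ∸ c B) * b ^ (length A + length B ∸ c B) * (t * (a * b)) ^ c B

    monoA? : ∀ f A → Dec (All (Monochromatic (liveUpTo? a) f) A)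
    monoA? f A = All.all? (monochromatic? (liveUpTo? a) f) A

    monoB? : ∀ f B → Dec (All (Monochromatic (liveAbove? a) f) B)
    monoB? f B = All.all? (monochromatic? (liveAbove? a) f) B

    g h : List (Edge n) → (Fin n → Fin k) → ℕ
    g A f = b ^ length A * 𝟙 (monoA? f A)
    h B f = b ^ length B * 𝟙 (monoB? f B)

    shuffle : ∀ x y z w → x * (y * z) * w ≡ y * z * (x * w)
    shuffle = solve-∀
    regroup : ∀ x y i j w → x * y * (i * j * w) ≡ x * i * (y * j) * w
    regroup = solve-∀

    term-disjoint : ∀ {A B} → VertexDisjoint A B →
      term A B ≡ b ^ length A * b ^ length B * (a ^ κ (A ++ B) * t ^ c B)
    term-disjoint {A} {B} disjoint = trans
      (^-∸-absorb a b t (c-disjoint≤κ-++ disjoint) (≤-trans (c≤length {F = B}) (m≤n+m (length B) (length A))))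
      (trans (cong (λ x → a ^ κ (A ++ B) * x * t ^ c B) (^-distribˡ-+-* b (length A) (length B)))
        (shuffle (a ^ κ (A ++ B)) (b ^ length A) (b ^ length B) (t ^ c B)))

    expand : ∀ A B → 𝟙 (vertexDisjoint? A B) * term A B ≋ ∑[ f ← fs ] (g A f * h B f * weight f)
    expand A B = begin
      𝟙 (vertexDisjoint? A B) * term A B
        -- The indicator provides the disjointness under which the truncated subtractions are exact.
        ≡⟨ 𝟙-*-cong (vertexDisjoint? A B) term-disjoint ⟩
      𝟙 (vertexDisjoint? A B) * (b ^ length A * b ^ length B * (a ^ κ (A ++ B) * t ^ c B))
        ≡⟨ *-Properties.x∙yz≈y∙xz (𝟙 (vertexDisjoint? A B)) (b ^ length A * b ^ length B) _ ⟩
      b ^ length A * b ^ length B * (𝟙 (vertexDisjoint? A B) * (a ^ κ (A ++ B) * t ^ c B))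
        -- The colourings enforce disjointness by themselves, so from here on `A` and `B` range
        -- independently.
        ≈⟨ *-≋ (≋-refl {b ^ length A * b ^ length B}) (∑-colourings-bichromatic m a t A B (vertexDisjoint? A B)) ⟨
      b ^ length A * b ^ length B * (∑[ f ← fs ] (𝟙 (monoA? f A ×-dec monoB? f B) * weight f))
        ≡⟨ ∑-*ˡ (b ^ length A * b ^ length B) _ fs ⟨
      ∑[ f ← fs ] (b ^ length A * b ^ length B * (𝟙 (monoA? f A ×-dec monoB? f B) * weight f))
        ≡⟨ ∑-cong fs (λ f → trans
             (cong (λ i → b ^ length A * b ^ length B * (i * weight f)) (𝟙-× (monoA? f A) (monoB? f B)))
             (regroup (b ^ length A) (b ^ length B) (𝟙 (monoA? f A)) (𝟙 (monoB? f B)) (weight f))) ⟩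
      ∑[ f ← fs ] (g A f * h B f * weight f) ∎

-- Ultimate periodicity of the three sequences.

S-periodic : ∀ a b c m → UltimatelyPeriodicMod (suc m) (λ n → ℤ.+ S (K n) a b c)
S-periodic a b c m = partitionFunction-periodic (monochromaticWeight (live? {suc b}) c)
  (λ d → if does (live? d) then a else 1) _
  (λ n → ≡⇒≋ (S≡partitionFunction n a b c))
  where open Congruence m

C-periodic : ∀ a b t m → UltimatelyPeriodicMod (suc m) (λ n → ℤ.+ C (K n) a b (suc t))
C-periodic a b t m = Congruence.partitionFunction-periodic m
  (monochromaticWeight live? b) (deadWeight (a * t * m)) _ (C≋partitionFunction m a b t)

ξ-periodic : ∀ a b t m → UltimatelyPeriodicMod (suc m) (λ n → ℤ.+ ξ (K n) a b (t * (a * b)))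
ξ-periodic a b t m = Congruence.partitionFunction-periodic m
  (bichromaticWeight m a b t) (deadWeight (a * t * m)) _ (ξ≋partitionFunction m a b t)

open import Data.Integer.Base using (+_)

theorem1p6 : (∀ (a b c μ : ℕ) .{{_ : NonZero a}} .{{_ : NonZero b}} .{{_ : NonZero c}} .{{_ : NonZero μ}} →
    UltimatelyPeriodicMod μ (λ n → + S (K n) a b c) ×
    UltimatelyPeriodicMod μ (λ n → + C (K n) a b c))
    ×
    (∀ (a b c : ℕ) .{{_ : NonZero a}} .{{_ : NonZero b}} .{{_ : NonZero c}} →
    a * b ∣ c →
    ∀ (μ : ℕ) .{{_ : NonZero μ}} →
    UltimatelyPeriodicMod μ (λ n → + ξ (K n) a b c))
theorem1p6 =
  -- Positivity of `c` and `μ` lets both be matched as successors; `t` is the `c - 1` that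
  -- determines the number of colours for `C`.
  (λ { a b (suc t) (suc m) → S-periodic a b (suc t) m , C-periodic a b t m }) ,
  -- Here `t` is the cofactor in `c = t * (a * b)`.
  (λ { a b _ (divides t refl) (suc m) → ξ-periodic a b t m })
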